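{- For any $n \geq 4$, there are $\lfloor \frac{n+1}{2} \rfloor$ completely independent spanning trees in $L(K_n)$ such that, for $n=4$ or any odd $n \geq 5$ and any vertex $v$ of $L(K_n)$ (respectively, for any even $n \geq 6$ and any induced path $P$ of order at most $\frac{n}{2}$ of $L(K_n)$), $\lfloor \frac{n+1}{2} \rfloor$ completely independent spanning trees still exist in $L(K_n)-v$ (respectively, in $L(K_n)-V(P)$).
   Context: $K_n$ is the complete graph on $n$ vertices, and $L(K_n)$ its line graph (vertex set $E(K_n)$, two vertices adjacent iff the corresponding edges share an endpoint). Spanning trees $T_1,\dots,T_k$ of a graph $H$ are completely independent if for any two distinct vertices $u,v$ of $H$, the $u$–$v$ paths in $T_1,\dots,T_k$ are pairwise edge-disjoint and pairwise share no vertex other than $u$ and $v$. An induced path of a graph $H$ is a set of vertices inducing a path in $H$; $H-X$ denotes deletion of the vertex set $X$. -}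

module Defs where

open import Data.Nat using (ℕ; suc; _≤_; _+_)
open import Data.Fin using (Fin; toℕ) renaming (_<_ to _<ᶠ_)
open import Data.List using (List; []; _∷_; length; lookup)
open import Data.List.Membership.Propositional using (_∈_; _∉_)
open import Data.List.Relation.Unary.Unique.Propositional using (Unique)
open import Data.Product using (Σ; _×_; _,_)
open import Data.Sum using (_⊎_)
open import Data.Unit using (⊤)
open import Data.Empty using (⊥)
open import Relation.Nullary using (¬_)
open import Relation.Binary.PropositionalEquality using (_≡_; _≢_)

-- Graphs: a vertex universe V, a predicate selecting the vertices of the
-- graph, and an adjacency relation (only used between vertices of the graph).

record Graph (V : Set) : Set₁ where
  field
    In  : V → Set
    Adj : V → V → Set
open Graph public

_─_ : {V : Set} → Graph V → List V → Graph V
In  (G ─ X) v   = In G v × v ∉ X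
Adj (G ─ X) u v = Adj G u v

Chain : {V : Set} → (V → V → Set) → List V → Set
Chain E []           = ⊤
Chain E (x ∷ [])     = ⊤
Chain E (x ∷ y ∷ xs) = E x y × Chain E (y ∷ xs)

data Head {V : Set} (u : V) : List V → Set where
  here : ∀ {xs} → Head u (u ∷ xs)

data Last {V : Set} (v : V) : List V → Set where
  last-one : Last v (v ∷ [])
  last-∷   : ∀ {x xs} → Last v xs → Last v (x ∷ xs)

IsPath : {V : Set} → (V → V → Set) → V → V → List V → Set
IsPath E u v xs = Head u xs × Last v xs × Unique xs × Chain E xs

IsCycle : {V : Set} → (V → V → Set) → List V → Set
IsCycle E xs = 3 ≤ length xs × Unique xs × Chain E xs
             × Σ _ λ u → Σ _ λ v → Head u xs × Last v xs × E v u

data Step {V : Set} (a b : V) : List V → Set where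
  step-here  : ∀ {xs} → Step a b (a ∷ b ∷ xs)
  step-there : ∀ {x xs} → Step a b xs → Step a b (x ∷ xs)

UsesEdge : {V : Set} → V → V → List V → Set
UsesEdge a b xs = Step a b xs ⊎ Step b a xs

record SpanningTree {V : Set} (G : Graph V) (E : V → V → Set) : Set where
  field
    sub       : ∀ {x y} → E x y → Adj G x y × In G x × In G y
    sym       : ∀ {x y} → E x y → E y x
    connected : ∀ u v → In G u → In G v → Σ (List V) (IsPath E u v)
    acyclic   : ∀ xs → ¬ IsCycle E xs

CompletelyIndependent : {V : Set} {k : ℕ} → Graph V → (Fin k → V → V → Set) → Set
CompletelyIndependent {V} G T =
  ∀ i j → i ≢ j → ∀ u v → In G u → In G v → u ≢ v →
  ∀ p q → IsPath (T i) u v p → IsPath (T j) u v q →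
    (∀ a b → UsesEdge a b p → UsesEdge a b q → ⊥)
  × (∀ w → w ∈ p → w ∈ q → w ≡ u ⊎ w ≡ v)

HasCISTs : {V : Set} → Graph V → ℕ → Set₁
HasCISTs {V} G k =
  Σ (Fin k → V → V → Set) λ T →
    (∀ i → SpanningTree G (T i)) × CompletelyIndependent G T

InducedPath : {V : Set} → Graph V → List V → Set
InducedPath G P =
  Unique P × (∀ x → x ∈ P → In G x) ×
  (∀ i j → (Adj G (lookup P i) (lookup P j) → toℕ i + 1 ≡ toℕ j ⊎ toℕ j + 1 ≡ toℕ i)
         × (toℕ i + 1 ≡ toℕ j ⊎ toℕ j + 1 ≡ toℕ i → Adj G (lookup P i) (lookup P j)))

-- The line graph L(K_n): vertices are the edges {i,j} of K_n, encoded as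
-- pairs (i , j) with i < j; two are adjacent iff distinct and sharing an
-- endpoint.

LKV : ℕ → Set
LKV n = Fin n × Fin n

LK : (n : ℕ) → Graph (LKV n)
In  (LK n) (i , j) = i <ᶠ j
Adj (LK n) (i , j) (k , l) =
  (i , j) ≢ (k , l) × (i ≡ k ⊎ i ≡ l ⊎ j ≡ k ⊎ j ≡ l)

{-# OPTIONS --safe #-}
module Submission where

-- A tree is given by a parent map.  If no vertex is a parent in two trees and
-- no edge lies in two trees, the trees are completely independent, because an
-- inner vertex of a tree path is a parent.  So it suffices to colour edges of
-- K_n such that each colour class is connected and every other edge e of K_n
-- can be hung as a leaf below an edge of that class sharing an end with e,
-- where no two edges hang below each other.  An uncoloured edge is a leaf of
-- every tree, hence may be deleted or not.
--
-- For even n = 2k the classes come from the decomposition of K_n into k double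
-- stars with centres aᵢbᵢ: for i < j, double star i contains aᵢaⱼ and bᵢbⱼ, and
-- double star j contains aⱼbᵢ and bⱼaᵢ.  Uncolouring one pendant edge of each
-- leaves the path a₀ a₁ … aₖ₋₁ b₀ uncoloured; an induced path of L(K_n) is a
-- path of K_n, and a permutation of the vertices moves it into this one.  For
-- odd n the star of one more vertex, with two edges changed, is added as a
-- further class, and one edge remains uncoloured.  Both constructions need
-- n ≥ 6; n = 4 and n = 5 are settled by explicit tables.

open import Defs
import Algebra.Construct.NaturalChoice.Max as Max
import Algebra.Construct.NaturalChoice.Min as Min
open import Data.Bool using (Bool; true; false; not; _xor_; if_then_else_)
open import Data.Bool.Properties using (xor-comm; not-¬) renaming (_≟_ to _≟ᵇ_)
open import Data.Empty using (⊥; ⊥-elim)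
open import Data.Fin using (Fin; zero; suc; toℕ; fromℕ<)
open import Data.Fin.Patterns using (0F; 1F; 2F; 3F; 4F)
open import Data.Fin.Permutation using (transpose; _⟨$⟩ʳ_)
open import Data.Fin.Properties using (toℕ-fromℕ<; toℕ-injective; toℕ<n; suc-injective; ≤-totalOrder; all?; *↔×; 2↔Bool) renaming (_≟_ to _≟ᶠ_; _<?_ to _<ᶠ?_)
open import Data.List using (List; []; _∷_; length; applyUpTo) renaming (map to mapᴸ)
open import Data.List.Membership.Propositional using (_∈_)
open import Data.List.Membership.Propositional.Properties using (∈-map⁺)
open import Data.List.Properties using (length-applyUpTo; map-cong-local)
open import Data.List.Relation.Unary.All as All using ([]; _∷_)
open import Data.List.Relation.Unary.All.Properties using (¬Any⇒All¬)
open import Data.List.Relation.Unary.AllPairs using ([]; _∷_)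
open import Data.List.Relation.Unary.Any using (here; there; index)
open import Data.List.Relation.Unary.Any.Properties using (lookup-index)
open import Data.List.Relation.Unary.Unique.Propositional using (Unique)
import Data.List.Relation.Unary.Unique.Propositional.Properties as Unique
open import Data.Maybe using (Maybe; just; nothing; fromMaybe)
import Data.Maybe.Properties as Maybe
open import Data.Nat using (ℕ; zero; suc; pred; _+_; _*_; _<_; _≤_; s≤s; z≤n; s≤s⁻¹; _≤?_; _<?_; ⌊_/2⌋; _%_)
open import Data.Nat.DivMod using (m*n%n≡0; [m+kn]%n≡m%n)
open import Data.Nat.Induction using (<-wellFounded)
import Data.Nat.Properties as ℕ
open import Data.Nat.Properties using (<-trans; <-asym; <-irrefl; <⇒≤; <⇒≱; ≤-refl; ≤-trans; ≤-antisym; ≰⇒≥; ≮⇒≥; ≤∧≢⇒<; n≤1+n)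
open import Data.Product using (∃; _×_; _,_; proj₁; proj₂; map; uncurry)
open import Data.Product.Function.NonDependent.Propositional using (_×-↔_)
open import Data.Product.Properties using (≡-dec)
open import Data.Sum using (_⊎_; inj₁; inj₂; swap; [_,_]′) renaming (map to map⊎)
open import Data.Unit using (tt)
open import Function using (_∘_; _↔_; Inverse; mk↔ₛ′)
open import Function.Construct.Composition using (_↔-∘_)
open import Function.Construct.Identity using (↔-id)
open import Induction.WellFounded using (Acc; acc)
open import Relation.Binary.Construct.Closure.ReflexiveTransitive using (Star; ε; _◅_; _◅◅_; reverse)
open import Relation.Binary.Definitions using (DecidableEquality; Symmetric)
open import Relation.Binary.PropositionalEquality using (_≡_; _≢_; refl; sym; trans; cong; cong₂; subst; subst₂; ≢-sym)
open import Relation.Nullary using (¬_; Dec; yes; no; ¬?; _×-dec_; _⊎-dec_; _→-dec_)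
open import Relation.Nullary.Decidable using (dec-true; dec-false; from-yes)

-- Paths extracted from walks.

last∈ : {V : Set} {v : V} {xs : List V} → Last v xs → v ∈ xs
last∈ last-one   = here refl
last∈ (last-∷ l) = there (last∈ l)

∉-head : {V : Set} {x y : V} {xs : List V} → Unique (x ∷ xs) → y ∈ xs → x ≢ y
∉-head (x∉ ∷ _) y∈ = All.lookup x∉ y∈

path-from : {V : Set} {E : V → V → Set} {x u v : V} {xs : List V} →
  IsPath E u v xs → x ∈ xs → ∃ (IsPath E x v)
path-from p@(Head.here , _) (here refl) = _ , p
path-from (Head.here , last-∷ l , _ ∷ un , _ , ch) (there {xs = _ ∷ _} x∈) =
  path-from (Head.here , l , un , ch) x∈

-- Loop erasure: if `u` already occurs on the path built from the rest of the walk, that path is cut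
-- to begin at this occurrence.
star⇒path : {V : Set} {E : V → V → Set} → DecidableEquality V →
  ∀ {u v} → Star E u v → ∃ (IsPath E u v)
star⇒path _≟_ ε = _ , Head.here , last-one , [] ∷ [] , tt
star⇒path _≟_ {u} (e ◅ es) with star⇒path _≟_ es
... | xs@(_ ∷ _) , p@(Head.here , l , un , ch) with u ∈? xs
  where open import Data.List.Membership.DecPropositional _≟_ using (_∈?_)
... | yes u∈ = path-from p u∈
... | no  u∉ = u ∷ xs , Head.here , last-∷ l , ¬Any⇒All¬ xs u∉ ∷ un , e , ch

step⇒edge : {V : Set} {E : V → V → Set} {a b : V} {xs : List V} → Chain E xs → Step a b xs → E a b
step⇒edge (e , _) step-here = e
step⇒edge {xs = _ ∷ _ ∷ _} (_ , ch) (step-there s) = step⇒edge ch s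

-- Trees given by parent maps.

-- k trees, each given by the parents of its non-root vertices.  The fields
-- inner-disjoint and no-swap say that no vertex is a parent in two trees and
-- no edge lies in two trees; this already makes the trees completely
-- independent.
record ParentMaps {V : Set} (G : Graph V) (k : ℕ) : Set where
  field
    root   : Fin k → V
    parent : Fin k → V → V
    depth  : Fin k → V → ℕ

  Par : Fin k → V → V → Set
  Par i x y = In G x × x ≢ root i × parent i x ≡ y

  field
    root-in        : ∀ i → In G (root i)
    parent-in      : ∀ {i x y} → Par i x y → In G y
    parent-adj     : ∀ {i x y} → Par i x y → Adj G x y
    parent-depth   : ∀ {i x y} → Par i x y → depth i y < depth i x
    inner-disjoint : ∀ {i j x y z} → i ≢ j → Par i x z → ¬ Par j y z
    no-swap        : ∀ {i j x y} → i ≢ j → Par i x y → ¬ Par j y x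

module _ {V : Set} {G : Graph V} {k : ℕ} (_≟_ : DecidableEquality V)
         (Adj-sym : Symmetric (Adj G)) (F : ParentMaps G k) where

  open ParentMaps F

  TreeEdge : Fin k → V → V → Set
  TreeEdge i x y = Par i x y ⊎ Par i y x

  Par-unique : ∀ {i x y z} → Par i x y → Par i x z → y ≡ z
  Par-unique (_ , _ , p) (_ , _ , q) = trans (sym p) q

  to-root : ∀ i u → In G u → Acc _<_ (depth i u) → Star (TreeEdge i) u (root i)
  to-root i u u-in (acc rec) with u ≟ root i
  ... | yes refl = ε
  ... | no  u≢r  = inj₁ up ◅ to-root i (parent i u) (parent-in up) (rec (parent-depth up))
    where
    up : Par i u (parent i u)
    up = u-in , u≢r , refl

  -- A path that has once stepped from parent to child can only go on to children.
  descent : ∀ {i x y v ys} → Unique (x ∷ y ∷ ys) → Chain (TreeEdge i) (x ∷ y ∷ ys) →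
    Par i y x → Last v (y ∷ ys) →
    depth i x < depth i v × ∃ λ w → Par i v w × (w ∈ y ∷ ys ⊎ v ≡ y)
  descent _ _ y↑x last-one = parent-depth y↑x , _ , y↑x , inj₂ refl
  descent {ys = z ∷ zs} ((_ ∷ x≢z ∷ _) ∷ _) (_ , inj₁ y↑z , _) y↑x (last-∷ l) =
    ⊥-elim (x≢z (Par-unique y↑x y↑z))
  descent {ys = z ∷ zs} (_ ∷ un) (_ , ch@(inj₂ z↑y , _)) y↑x (last-∷ l)
    with descent un ch z↑y l
  ... | y<v , w , v↑w , inj₁ w∈    = <-trans (parent-depth y↑x) y<v , w , v↑w , inj₁ (there w∈)
  ... | y<v , w , v↑w , inj₂ refl = <-trans (parent-depth y↑x) y<v , _ , z↑y , inj₁ (here refl)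

  -- A path that starts upwards can turn only once. If it never turns, its end is less deep than its
  -- start; if it turns, `descent` finds the parent of its end on the path.
  ascent : ∀ {i x y v ys} → Unique (x ∷ y ∷ ys) → Chain (TreeEdge i) (x ∷ y ∷ ys) →
    Par i x y → Last v (y ∷ ys) →
    depth i v < depth i x ⊎ ∃ λ w → Par i v w × w ∈ y ∷ ys
  ascent _ _ x↑y last-one = inj₁ (parent-depth x↑y)
  ascent {ys = z ∷ zs} (_ ∷ un) (_ , ch@(inj₁ y↑z , _)) x↑y (last-∷ l) with ascent un ch y↑z l
  ... | inj₁ v<y           = inj₁ (<-trans v<y (parent-depth x↑y))
  ... | inj₂ (w , v↑w , w∈) = inj₂ (w , v↑w , there w∈)
  ascent {ys = z ∷ zs} (_ ∷ un) (_ , ch@(inj₂ z↑y , _)) x↑y (last-∷ l) with descent un ch z↑y l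
  ... | _ , w , v↑w , inj₁ w∈   = inj₂ (w , v↑w , there w∈)
  ... | _ , w , v↑w , inj₂ refl = inj₂ (_ , z↑y , here refl)

  -- The closing edge joins the last vertex `v` to `x`. If `x` is the parent of `v`, then `ascent`
  -- or `descent` either contradicts the depths, or finds this parent among the vertices after `x`,
  -- or makes `v` the second vertex, which length at least 3 forbids. If `v` is the parent of `x`,
  -- then `y` is no second parent of `x`, and a descending start makes `v` too deep.
  no-cycle : ∀ i xs → ¬ IsCycle (TreeEdge i) xs
  no-cycle i (x ∷ y ∷ z ∷ zs) (_ , un@(_ ∷ un′) , ch@(e , _) , .x , v , Head.here , last-∷ (last-∷ l) , e′) =
    refute e e′
    where
    y≢v : y ≢ v
    y≢v = ∉-head un′ (last∈ l)
    refute : TreeEdge i x y → TreeEdge i v x → ⊥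
    refute (inj₁ x↑y) (inj₂ x↑v) = y≢v (Par-unique x↑y x↑v)
    refute (inj₁ x↑y) (inj₁ v↑x) with ascent un ch x↑y (last-∷ l)
    ... | inj₁ v<x           = <-asym v<x (parent-depth v↑x)
    ... | inj₂ (w , v↑w , w∈) = ∉-head un w∈ (Par-unique v↑x v↑w)
    refute (inj₂ y↑x) e″ with descent un ch y↑x (last-∷ l) | e″
    ... | x<v , _ | inj₂ x↑v = <-asym x<v (parent-depth x↑v)
    ... | _ , w , v↑w , inj₁ w∈   | inj₁ v↑x = ∉-head un w∈ (Par-unique v↑x v↑w)
    ... | _ , w , v↑w , inj₂ refl | inj₁ v↑x = y≢v refl
  no-cycle i (_ ∷ []) (s≤s () , _)
  no-cycle i (_ ∷ _ ∷ []) (s≤s (s≤s ()) , _)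

  -- Of its two distinct neighbours on the path, at most one is its parent.
  inner⇒parent : ∀ {i x v w ys} → Unique (x ∷ ys) → Chain (TreeEdge i) (x ∷ ys) →
    Last v (x ∷ ys) → w ∈ ys → w ≢ v → ∃ λ c → Par i c w
  inner⇒parent {ys = y ∷ []} _ _ (last-∷ last-one) (here refl) w≢v = ⊥-elim (w≢v refl)
  inner⇒parent {ys = y ∷ z ∷ zs} _ (inj₁ x↑y , _) _ (here refl) _ = _ , x↑y
  inner⇒parent {ys = y ∷ z ∷ zs} _ (_ , inj₂ z↑y , _) _ (here refl) _ = _ , z↑y
  inner⇒parent {ys = y ∷ z ∷ zs} ((_ ∷ x≢z ∷ _) ∷ _) (inj₂ y↑x , inj₁ y↑z , _) _ (here refl) _ =
    ⊥-elim (x≢z (Par-unique y↑x y↑z))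
  inner⇒parent {ys = y ∷ ys} (_ ∷ un) (_ , ch) (last-∷ l) (there w∈) w≢v =
    inner⇒parent un ch l w∈ w≢v

  -- If both trees orient the edge alike, its upper end is a parent in both; opposite orientations
  -- are excluded by `no-swap`.
  tree-edges-disjoint : ∀ {i j a b} → i ≢ j → TreeEdge i a b → ¬ TreeEdge j a b
  tree-edges-disjoint i≢j (inj₁ p) (inj₁ q) = inner-disjoint i≢j p q
  tree-edges-disjoint i≢j (inj₁ p) (inj₂ q) = no-swap i≢j p q
  tree-edges-disjoint i≢j (inj₂ p) (inj₁ q) = no-swap i≢j p q
  tree-edges-disjoint i≢j (inj₂ p) (inj₂ q) = inner-disjoint i≢j p q

  uses⇒edge : ∀ {i a b xs} → Chain (TreeEdge i) xs → UsesEdge a b xs → TreeEdge i a b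
  uses⇒edge ch (inj₁ s) = step⇒edge ch s
  uses⇒edge ch (inj₂ s) = swap (step⇒edge ch s)

  parentMaps⇒CISTs : HasCISTs G k
  parentMaps⇒CISTs = TreeEdge , spanning , independent
    where
    spanning : ∀ i → SpanningTree G (TreeEdge i)
    spanning i = record
      { sub       = λ { (inj₁ p) → parent-adj p , proj₁ p , parent-in p
                      ; (inj₂ p) → Adj-sym (parent-adj p) , parent-in p , proj₁ p }
      ; sym       = swap
      ; connected = λ u v u-in v-in → star⇒path _≟_
          (to-root i u u-in (<-wellFounded _) ◅◅ reverse swap (to-root i v v-in (<-wellFounded _)))
      ; acyclic   = no-cycle i
      }
    independent : CompletelyIndependent G TreeEdge
    independent i j i≢j u v _ _ _ (.u ∷ p) (.u ∷ q)
      (Head.here , lp , up , cp) (Head.here , lq , uq , cq) =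
      (λ a b ap aq → tree-edges-disjoint i≢j (uses⇒edge cp ap) (uses⇒edge cq aq)) , meet
      where
      meet : ∀ w → w ∈ u ∷ p → w ∈ u ∷ q → w ≡ u ⊎ w ≡ v
      meet w (here w≡u) _ = inj₁ w≡u
      meet w (there _) (here w≡u) = inj₁ w≡u
      meet w (there w∈p) (there w∈q) with w ≟ v
      ... | yes w≡v = inj₂ w≡v
      ... | no  w≢v = ⊥-elim (inner-disjoint i≢j
              (proj₂ (inner⇒parent up cp lp w∈p w≢v)) (proj₂ (inner⇒parent uq cq lq w∈q w≢v)))

-- Edges up to orientation, and coloured kernels.

-- Unlike `Adj`, this also holds between equal edges, so `centre-meets` may include the centre
-- itself.
Meets : {W : Set} → W × W → W × W → Set
Meets (u , v) (s , t) = u ≡ s ⊎ u ≡ t ⊎ v ≡ s ⊎ v ≡ t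

infix 4 _≈_

_≈_ : {W : Set} → W × W → W × W → Set
(u , v) ≈ (s , t) = (u ≡ s × v ≡ t) ⊎ (u ≡ t × v ≡ s)

≈-sym : {W : Set} {e f : W × W} → e ≈ f → f ≈ e
≈-sym (inj₁ (refl , refl)) = inj₁ (refl , refl)
≈-sym (inj₂ (refl , refl)) = inj₂ (refl , refl)

Meets-sym : {W : Set} {e f : W × W} → Meets e f → Meets f e
Meets-sym (inj₁ p)               = inj₁ (sym p)
Meets-sym (inj₂ (inj₁ p))        = inj₂ (inj₂ (inj₁ (sym p)))
Meets-sym (inj₂ (inj₂ (inj₁ p))) = inj₂ (inj₁ (sym p))
Meets-sym (inj₂ (inj₂ (inj₂ p))) = inj₂ (inj₂ (inj₂ (sym p)))

Meets-≈ : {W : Set} {e f g : W × W} → Meets e f → g ≈ f → Meets e g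
Meets-≈ m (inj₁ (refl , refl)) = m
Meets-≈ (inj₁ p)               (inj₂ (refl , refl)) = inj₂ (inj₁ p)
Meets-≈ (inj₂ (inj₁ p))        (inj₂ (refl , refl)) = inj₁ p
Meets-≈ (inj₂ (inj₂ (inj₁ p))) (inj₂ (refl , refl)) = inj₂ (inj₂ (inj₂ p))
Meets-≈ (inj₂ (inj₂ (inj₂ p))) (inj₂ (refl , refl)) = inj₂ (inj₂ (inj₁ p))

-- Uncoloured edges have colour nothing.  Meeting centre i in all its edges,
-- class i is connected in the line graph.
record Classes (W : Set) (k : ℕ) : Set where
  field
    colour        : W → W → Maybe (Fin k)
    centre        : Fin k → W × W
    colour-sym    : ∀ u v → colour u v ≡ colour v u
    centre-≢      : ∀ i → proj₁ (centre i) ≢ proj₂ (centre i)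
    centre-colour : ∀ i → uncurry colour (centre i) ≡ just i
    centre-meets  : ∀ {i u v} → colour u v ≡ just i → Meets (u , v) (centre i)

  colour-≈ : ∀ {e f} → e ≈ f → uncurry colour e ≡ uncurry colour f
  colour-≈ (inj₁ (refl , refl)) = refl
  colour-≈ (inj₂ (refl , refl)) = colour-sym _ _

-- pick i u v is an edge of colour i through which the edge uv, not of colour
-- i, hangs as a leaf of the i-th tree.
record LineKernel (W : Set) (k : ℕ) : Set where
  field
    classes : Classes W k
  open Classes classes public
  field
    pick         : Fin k → W → W → W × W
    pick-≢       : ∀ i {u v} → u ≢ v → proj₁ (pick i u v) ≢ proj₂ (pick i u v)
    pick-colour  : ∀ i {u v} → u ≢ v → uncurry colour (pick i u v) ≡ just i
    pick-meets   : ∀ i {u v} → u ≢ v → colour u v ≢ just i → Meets (u , v) (pick i u v)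
    pick-no-swap : ∀ {i j u v s t} → i ≢ j → u ≢ v → colour u v ≡ just j → s ≢ t → colour s t ≡ just i →
                   pick i u v ≈ (s , t) → ¬ pick j s t ≈ (u , v)

-- Kernels are built on convenient vertex sets and carried to `Fin n` by a bijection; the freedom in
-- choosing it will move a prescribed path onto uncoloured edges.
pullback : ∀ {X W k} → X ↔ W → LineKernel W k → LineKernel X k
pullback π K = record
  { classes = record
    { colour        = λ x y → colour (to x) (to y)
    ; centre        = map from from ∘ centre
    ; colour-sym    = λ x y → colour-sym (to x) (to y)
    ; centre-≢      = λ i → centre-≢ i ∘ from-injective
    ; centre-colour = λ i → trans (to∘from-colour (centre i)) (centre-colour i)
    ; centre-meets  = Meets-from _ ∘ centre-meets
    }
  ; pick         = λ i x y → map from from (pick i (to x) (to y))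
  ; pick-≢       = λ i x≢y → pick-≢ i (x≢y ∘ to-injective) ∘ from-injective
  ; pick-colour  = λ i x≢y → trans (to∘from-colour (pick i _ _)) (pick-colour i (x≢y ∘ to-injective))
  ; pick-meets   = λ i x≢y c → Meets-from _ (pick-meets i (x≢y ∘ to-injective) c)
  ; pick-no-swap = λ i≢j x≢y c s≢t c′ p q →
      pick-no-swap i≢j (x≢y ∘ to-injective) c (s≢t ∘ to-injective) c′ (≈-to p) (≈-to q)
  }
  where
  open LineKernel K
  open Inverse π using (to; from; strictlyInverseˡ; strictlyInverseʳ)

  from-injective : ∀ {u v} → from u ≡ from v → u ≡ v
  from-injective p = trans (sym (strictlyInverseˡ _)) (trans (cong to p) (strictlyInverseˡ _))

  to-injective : ∀ {x y} → to x ≡ to y → x ≡ y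
  to-injective p = trans (sym (strictlyInverseʳ _)) (trans (cong from p) (strictlyInverseʳ _))

  to∘from-colour : ∀ e → colour (to (from (proj₁ e))) (to (from (proj₂ e))) ≡ uncurry colour e
  to∘from-colour _ = cong₂ colour (strictlyInverseˡ _) (strictlyInverseˡ _)

  ≡-from : ∀ {x u} → to x ≡ u → x ≡ from u
  ≡-from p = trans (sym (strictlyInverseʳ _)) (cong from p)

  from-≡ : ∀ {x u} → from u ≡ x → u ≡ to x
  from-≡ p = trans (sym (strictlyInverseˡ _)) (cong to p)

  Meets-from : ∀ {x y} e → Meets (to x , to y) e → Meets (x , y) (map from from e)
  Meets-from _ (inj₁ p)               = inj₁ (≡-from p)
  Meets-from _ (inj₂ (inj₁ p))        = inj₂ (inj₁ (≡-from p))
  Meets-from _ (inj₂ (inj₂ (inj₁ p))) = inj₂ (inj₂ (inj₁ (≡-from p)))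
  Meets-from _ (inj₂ (inj₂ (inj₂ p))) = inj₂ (inj₂ (inj₂ (≡-from p)))

  ≈-to : ∀ {e x y} → map from from e ≈ (x , y) → e ≈ (to x , to y)
  ≈-to (inj₁ (p , q)) = inj₁ (from-≡ p , from-≡ q)
  ≈-to (inj₂ (p , q)) = inj₂ (from-≡ p , from-≡ q)

-- From a kernel to spanning trees of the line graph.

-- A common form of `LK n` and `LK n ─ P`: by eta, each is the restriction to its own `In`.
LK-restrict : ∀ n → (LKV n → Set) → Graph (LKV n)
LK-restrict n I = record { In = I ; Adj = Adj (LK n) }

module _ {n k : ℕ} (K : LineKernel (Fin n) k) (I : LKV n → Set)
         (I⇒In : ∀ {e} → I e → In (LK n) e)
         (coloured⇒I : ∀ {e i} → In (LK n) e → uncurry (LineKernel.colour K) e ≡ just i → I e) where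

  open LineKernel K

  private
    edge : Fin n × Fin n → LKV n
    edge (u , v) with u <ᶠ? v
    ... | yes _ = u , v
    ... | no  _ = v , u

    edge-≈ : ∀ e → edge e ≈ e
    edge-≈ (u , v) with u <ᶠ? v
    ... | yes _ = inj₁ (refl , refl)
    ... | no  _ = inj₂ (refl , refl)

    edge-in : ∀ e → proj₁ e ≢ proj₂ e → In (LK n) (edge e)
    edge-in (u , v) u≢v with u <ᶠ? v
    ... | yes u<v = u<v
    ... | no  u≮v = ≤∧≢⇒< (≮⇒≥ u≮v) (u≢v ∘ sym ∘ toℕ-injective)

    ends-≢ : ∀ {e} → In (LK n) e → proj₁ e ≢ proj₂ e
    ends-≢ u<v refl = <⇒≱ u<v ≤-refl

    _≟ᵉ_ : DecidableEquality (LKV n)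
    _≟ᵉ_ = ≡-dec _≟ᶠ_ _≟ᶠ_

    colourᵉ : LKV n → Maybe (Fin k)
    colourᵉ = uncurry colour

    _≟ᶜ_ : DecidableEquality (Maybe (Fin k))
    _≟ᶜ_ = Maybe.≡-dec _≟ᶠ_

    root : Fin k → LKV n
    root = edge ∘ centre

    parent : Fin k → LKV n → LKV n
    parent i e with colourᵉ e ≟ᶜ just i
    ... | yes _ = root i
    ... | no  _ = edge (uncurry (pick i) e)

    depth : Fin k → LKV n → ℕ
    depth i e with e ≟ᵉ root i | colourᵉ e ≟ᶜ just i
    ... | yes _ | _     = 0
    ... | no  _ | yes _ = 1
    ... | no  _ | no  _ = 2

    root-colour : ∀ i → colourᵉ (root i) ≡ just i
    root-colour i = trans (colour-≈ (edge-≈ (centre i))) (centre-colour i)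

    Par : Fin k → LKV n → LKV n → Set
    Par i x y = I x × x ≢ root i × parent i x ≡ y

    -- This separates the inner vertices of different trees, and it keeps every parent in `I`, since
    -- only uncoloured edges may be missing there.
    Par-colour : ∀ {i x y} → Par i x y → colourᵉ y ≡ just i
    Par-colour {i} {x} (x-in , _ , refl) with colourᵉ x ≟ᶜ just i
    ... | yes _ = root-colour i
    ... | no  _ = trans (colour-≈ (edge-≈ _)) (pick-colour i (ends-≢ (I⇒In x-in)))

    Par-in : ∀ {i x y} → Par i x y → In (LK n) y
    Par-in {i} {x} (x-in , _ , refl) with colourᵉ x ≟ᶜ just i
    ... | yes _ = edge-in (centre i) (centre-≢ i)
    ... | no  _ = edge-in _ (pick-≢ i (ends-≢ (I⇒In x-in)))

    Par-adj : ∀ {i x y} → Par i x y → Adj (LK n) x y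
    Par-adj {i} {x} (x-in , x≢r , refl) with colourᵉ x ≟ᶜ just i
    ... | yes c = x≢r , Meets-≈ (centre-meets c) (edge-≈ (centre i))
    ... | no ¬c = (λ x≡p → ¬c (trans (cong colourᵉ x≡p)
                                     (trans (colour-≈ (edge-≈ _)) (pick-colour i (ends-≢ (I⇒In x-in))))))
                , Meets-≈ (pick-meets i (ends-≢ (I⇒In x-in)) ¬c) (edge-≈ _)

    Par-depth : ∀ {i x y} → Par i x y → depth i y < depth i x
    Par-depth {i} {x} {y} (x-in , x≢r , e) with x ≟ᵉ root i | colourᵉ x ≟ᶜ just i
    ... | yes x≡r | _ = ⊥-elim (x≢r x≡r)
    ... | no  _ | yes _ with y ≟ᵉ root i
    ...   | yes _  = s≤s z≤n
    ...   | no y≢r = ⊥-elim (y≢r (sym e))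
    Par-depth {i} {x} {y} (x-in , x≢r , e) | no _ | no ¬c with y ≟ᵉ root i | colourᵉ y ≟ᶜ just i
    ...   | yes _ | _     = s≤s z≤n
    ...   | no  _ | yes _ = s≤s (s≤s z≤n)
    ...   | no  _ | no ¬c′ = ⊥-elim (¬c′ (trans (cong colourᵉ (sym e))
                               (trans (colour-≈ (edge-≈ _)) (pick-colour i (ends-≢ (I⇒In x-in))))))

    Par-pick : ∀ {i j x y} → i ≢ j → Par i x y → colourᵉ x ≡ just j → uncurry (pick i) x ≈ y
    Par-pick {i} {x = x} i≢j (_ , _ , refl) c with colourᵉ x ≟ᶜ just i
    ... | yes c′ = ⊥-elim (i≢j (Maybe.just-injective (trans (sym c′) c)))
    ... | no  _  = ≈-sym (edge-≈ _)

    -- Mutual parents `x` and `y` have colours `j` and `i`, so neither hangs directly below the root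
    -- on account of its own colour; both hang by `pick`, contrary to `pick-no-swap`.
    no-swap : ∀ {i j x y} → i ≢ j → Par i x y → ¬ Par j y x
    no-swap i≢j p q = pick-no-swap i≢j (ends-≢ (Par-in q)) (Par-colour q) (ends-≢ (Par-in p)) (Par-colour p)
      (Par-pick i≢j p (Par-colour q)) (Par-pick (≢-sym i≢j) q (Par-colour p))

  lineKernel⇒CISTs : HasCISTs (LK-restrict n I) k
  lineKernel⇒CISTs = parentMaps⇒CISTs _≟ᵉ_ (λ (ne , m) → ≢-sym ne , Meets-sym m) record
    { root           = root
    ; parent         = parent
    ; depth          = depth
    ; root-in        = λ i → coloured⇒I (edge-in (centre i) (centre-≢ i)) (root-colour i)
    ; parent-in      = λ p → coloured⇒I (Par-in p) (Par-colour p)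
    ; parent-adj     = Par-adj
    ; parent-depth   = Par-depth
    ; inner-disjoint = λ i≢j p q → i≢j (Maybe.just-injective (trans (sym (Par-colour p)) (Par-colour q)))
    ; no-swap        = no-swap
    }

-- Choosing attachment ends by priorities.

-- Each class spans all vertices but gap i.  With respect to colour i, an edge
-- of colour j is attached at its end s of smaller priority i j, to the edge
-- joining s to nb i j s.  As edges of different colours are different, two
-- edges can only choose each other by being attached at a common end s, which
-- decreasing excludes.
record PriorityKernel (W : Set) (k : ℕ) : Set where
  field
    classes : Classes W k
  open Classes classes public
  field
    gap        : Fin k → W
    nb         : Fin k → Fin k → W → W
    priority   : Fin k → Fin k → W → ℕ
    nb-≢       : ∀ i j {w} → w ≢ gap i → w ≢ nb i j w
    nb-colour  : ∀ i j {w} → w ≢ gap i → colour w (nb i j w) ≡ just i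
    gap-last   : ∀ i j {w} → w ≢ gap i → priority i j w < priority i j (gap i)
    decreasing : ∀ {i j} s → i ≢ j → s ≢ gap i → s ≢ gap j →
                 priority i j (nb j i s) < priority i j s ⊎ priority j i (nb i j s) < priority j i s

module _ {W : Set} (f : W → ℕ) where

  argmin : W → W → W
  argmin u v with f u ≤? f v
  ... | yes _ = u
  ... | no  _ = v

  argmin-cases : ∀ u v → (argmin u v ≡ u × f u ≤ f v) ⊎ (argmin u v ≡ v × f v ≤ f u)
  argmin-cases u v with f u ≤? f v
  ... | yes p = inj₁ (refl , p)
  ... | no ¬p = inj₂ (refl , ≰⇒≥ ¬p)

  -- Minimality in the form used below, where the other end `o` is a vertex `nb` known to lie on the
  -- edge only through `≈`.
  argmin-≤ : ∀ {o} u v → (argmin u v , o) ≈ (u , v) → f (argmin u v) ≤ f o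
  argmin-≤ u v _ with argmin u v | argmin-cases u v
  argmin-≤ u v (inj₁ (_ , refl)) | _ | inj₁ (refl , p) = p
  argmin-≤ u v (inj₂ (_ , refl)) | _ | inj₁ (refl , p) = ≤-refl
  argmin-≤ u v (inj₁ (_ , refl)) | _ | inj₂ (refl , p) = ≤-refl
  argmin-≤ u v (inj₂ (_ , refl)) | _ | inj₂ (refl , p) = p

module _ {W : Set} {k : ℕ} (K : PriorityKernel W k) where

  open PriorityKernel K

  private
    tail : Fin k → Fin k → W → W → W
    tail i j = argmin (priority i j)

    -- Only one end of an edge can be the gap, and by `gap-last` the other end then has strictly
    -- smaller priority.
    tail-≢gap : ∀ i j {u v} → u ≢ v → tail i j u v ≢ gap i
    tail-≢gap i j {u} {v} u≢v t≡g with tail i j u v | argmin-cases (priority i j) u v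
    ... | _ | inj₁ (refl , p) rewrite t≡g = <⇒≱ (gap-last i j (u≢v ∘ sym)) p
    ... | _ | inj₂ (refl , p) rewrite t≡g = <⇒≱ (gap-last i j u≢v) p

    pick : Fin k → W → W → W × W
    pick i u v = tail i j u v , nb i j (tail i j u v)
      where
      -- For an uncoloured edge the default `i` still yields an end other than `gap i`, and
      -- `pick-no-swap` speaks of coloured edges only.
      j = fromMaybe i (colour u v)

    colour-functional : ∀ {i j u v} → i ≢ j → colour u v ≡ just i → colour u v ≢ just j
    colour-functional i≢j p q = i≢j (Maybe.just-injective (trans (sym p) q))

    no-swap : ∀ {i j u v s t} → i ≢ j → u ≢ v → colour u v ≡ just j → s ≢ t → colour s t ≡ just i →
      (tail i j u v , nb i j (tail i j u v)) ≈ (s , t) →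
      ¬ (tail j i s t , nb j i (tail j i s t)) ≈ (u , v)
    no-swap {i} {j} {u} {v} {s} {t} i≢j u≢v cuv s≢t cst p q = same-end (end p)
      where
      a = tail i j u v
      b = tail j i s t

      a≢gap : a ≢ gap i
      a≢gap = tail-≢gap i j u≢v

      end : (a , nb i j a) ≈ (s , t) → b ≡ a ⊎ b ≡ nb i j a
      end a≈ with argmin-cases (priority j i) s t | a≈
      ... | inj₁ (r , _) | inj₁ (x , y) = inj₁ (trans r (sym x))
      ... | inj₁ (r , _) | inj₂ (x , y) = inj₂ (trans r (sym y))
      ... | inj₂ (r , _) | inj₁ (x , y) = inj₂ (trans r (sym y))
      ... | inj₂ (r , _) | inj₂ (x , y) = inj₁ (trans r (sym x))

      on-uv : (b ≡ u) ⊎ (b ≡ v)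
      on-uv = [ inj₁ ∘ proj₁ , inj₂ ∘ proj₁ ]′ q

      same-end : b ≡ a ⊎ b ≡ nb i j a → ⊥
      -- Both edges are attached at `a`, which is minimal on each of them for the respective
      -- priority.
      same-end (inj₁ b≡a) = [ (λ l → <⇒≱ l ≤₁) , (λ l → <⇒≱ l ≤₂) ]′
        (decreasing a i≢j a≢gap (subst (_≢ gap j) b≡a (tail-≢gap j i s≢t)))
        where
        ≤₁ : priority i j a ≤ priority i j (nb j i a)
        ≤₁ = argmin-≤ (priority i j) u v (subst (λ w → (w , nb j i w) ≈ (u , v)) b≡a q)
        ≤₂ : priority j i a ≤ priority j i (nb i j a)
        ≤₂ = subst (λ w → priority j i w ≤ priority j i (nb i j a)) b≡a
               (argmin-≤ (priority j i) s t (subst (λ w → (w , nb i j a) ≈ (s , t)) (sym b≡a) p))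
      -- Here `b` is the end of `uv` other than `a`, so `uv` joins `a` to `nb i j a` and has colour
      -- `i` as well as `j`.
      same-end (inj₂ b≡n) with argmin-cases (priority i j) u v | on-uv
      ... | inj₁ (a≡u , _) | inj₁ b≡u = nb-≢ i j a≢gap (trans a≡u (trans (sym b≡u) b≡n))
      ... | inj₂ (a≡v , _) | inj₂ b≡v = nb-≢ i j a≢gap (trans a≡v (trans (sym b≡v) b≡n))
      ... | inj₁ (a≡u , _) | inj₂ b≡v = colour-functional (i≢j ∘ sym) cuv
              (trans (cong₂ colour (sym a≡u) (trans (sym b≡v) b≡n)) (nb-colour i j a≢gap))
      ... | inj₂ (a≡v , _) | inj₁ b≡u = colour-functional (i≢j ∘ sym) cuv
              (trans (colour-sym u v) (trans (cong₂ colour (sym a≡v) (trans (sym b≡u) b≡n)) (nb-colour i j a≢gap)))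

    pick-meets : ∀ i u v → Meets (u , v) (pick i u v)
    pick-meets i u v with argmin-cases (priority i (fromMaybe i (colour u v))) u v
    ... | inj₁ (p , _) = inj₁ (sym p)
    ... | inj₂ (p , _) = inj₂ (inj₂ (inj₁ (sym p)))

  fromPriorities : LineKernel W k
  fromPriorities = record
    { classes      = classes
    ; pick         = pick
    ; pick-≢       = λ i u≢v → nb-≢ i _ (tail-≢gap i _ u≢v)
    ; pick-colour  = λ i u≢v → nb-colour i _ (tail-≢gap i _ u≢v)
    ; pick-meets   = λ i _ _ → pick-meets i _ _
    ; pick-no-swap = λ i≢j u≢v cuv s≢t cst p q → no-swap i≢j u≢v cuv s≢t cst
        -- The index computed inside `pick` is replaced by the known colour of the edge.
        (subst (λ c → (tail _ (fromMaybe _ c) _ _ , nb _ (fromMaybe _ c) (tail _ (fromMaybe _ c) _ _)) ≈ _) cuv p)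
        (subst (λ c → (tail _ (fromMaybe _ c) _ _ , nb _ (fromMaybe _ c) (tail _ (fromMaybe _ c) _ _)) ≈ _) cst q)
    }

-- Induced paths of the line graph as paths of the complete graph.

On : {W : Set} → W → W × W → Set
On x (u , v) = x ≡ u ⊎ x ≡ v

-- Edges are matched up to orientation, because vertices of `LK n` are stored with increasing ends
-- while a path may run through them either way.
data Along {W : Set} : List W → List (W × W) → Set where
  []  : ∀ {x} → Along (x ∷ []) []
  _∷_ : ∀ {e x y xs P} → e ≈ (x , y) → Along (y ∷ xs) P → Along (x ∷ y ∷ xs) (e ∷ P)

Along-length : ∀ {W : Set} {xs : List W} {P} → Along xs P → length xs ≡ suc (length P)
Along-length []      = refl
Along-length (_ ∷ a) = cong suc (Along-length a)

Along-on : ∀ {W : Set} {xs : List W} {e P w} → Along xs (e ∷ P) → w ∈ xs → ∃ λ f → f ∈ e ∷ P × On w f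
Along-on (inj₁ (refl , _) ∷ _)    (here refl)         = _ , here refl , inj₁ refl
Along-on (inj₂ (_ , refl) ∷ _)    (here refl)         = _ , here refl , inj₂ refl
Along-on (inj₁ (_ , refl) ∷ [])   (there (here refl)) = _ , here refl , inj₂ refl
Along-on (inj₂ (refl , _) ∷ [])   (there (here refl)) = _ , here refl , inj₁ refl
Along-on (_ ∷ a@(_ ∷ _)) (there w∈) with Along-on a w∈
... | f , f∈ , on = f , there f∈ , on

on-both⇒Meets : ∀ {W : Set} {x : W} {e f} → On x e → On x f → Meets e f
on-both⇒Meets (inj₁ refl) (inj₁ refl) = inj₁ refl
on-both⇒Meets (inj₁ refl) (inj₂ refl) = inj₂ (inj₁ refl)
on-both⇒Meets (inj₂ refl) (inj₁ refl) = inj₂ (inj₂ (inj₁ refl))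
on-both⇒Meets (inj₂ refl) (inj₂ refl) = inj₂ (inj₂ (inj₂ refl))

other-end : ∀ {W : Set} {y : W} {f} → On y f → ∃ λ z → f ≈ (y , z)
other-end (inj₁ refl) = _ , inj₁ (refl , refl)
other-end (inj₂ refl) = _ , inj₂ (refl , refl)

meets-end : ∀ {W : Set} {x y : W} {e f} → e ≈ (x , y) → Meets e f → ¬ On x f → On y f
meets-end (inj₁ (refl , refl)) (inj₁ p)               ¬x = ⊥-elim (¬x (inj₁ p))
meets-end (inj₁ (refl , refl)) (inj₂ (inj₁ p))        ¬x = ⊥-elim (¬x (inj₂ p))
meets-end (inj₁ (refl , refl)) (inj₂ (inj₂ on))       ¬x = on
meets-end (inj₂ (refl , refl)) (inj₁ p)               ¬x = inj₁ p
meets-end (inj₂ (refl , refl)) (inj₂ (inj₁ p))        ¬x = inj₂ p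
meets-end (inj₂ (refl , refl)) (inj₂ (inj₂ on))       ¬x = ⊥-elim (¬x on)

≈-snd-on : ∀ {W : Set} {x y : W} {e} → e ≈ (x , y) → On y e
≈-snd-on (inj₁ (_ , refl)) = inj₂ refl
≈-snd-on (inj₂ (refl , _)) = inj₁ refl

module _ {n : ℕ} where

  on-both⇒≡ : ∀ {e f} → In (LK n) e → In (LK n) f → On (proj₁ e) f → On (proj₂ e) f → e ≡ f
  on-both⇒≡ _   _   (inj₁ refl) (inj₂ refl) = refl
  on-both⇒≡ e<  f<  (inj₂ refl) (inj₁ refl) = ⊥-elim (<-asym e< f<)
  on-both⇒≡ e<  _   (inj₁ refl) (inj₁ refl) = ⊥-elim (<-irrefl refl e<)
  on-both⇒≡ e<  _   (inj₂ refl) (inj₂ refl) = ⊥-elim (<-irrefl refl e<)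

  induced-adj : ∀ {e f P} → InducedPath (LK n) (e ∷ f ∷ P) → Adj (LK n) e f
  induced-adj (_ , _ , adj) = proj₂ (adj zero (suc zero)) (inj₁ refl)

  -- The positions of `e` and `g` differ by at least two, and `e` differs from `g`, so a common end
  -- would be a forbidden adjacency.
  induced-apart : ∀ {e f g P} → InducedPath (LK n) (e ∷ f ∷ P) → g ∈ P → ¬ Meets e g
  induced-apart {e} {f} {P = P} (e∉ ∷ _ , _ , adj) g∈ m
    with proj₁ (adj zero (suc (suc (index g∈))))
           (subst (Adj (LK n) e) (lookup-index g∈) (All.lookup e∉ (there g∈) , m))
  ... | inj₁ ()
  ... | inj₂ ()

  induced-tail : ∀ {e P} → InducedPath (LK n) (e ∷ P) → InducedPath (LK n) P
  induced-tail (_ ∷ un , ins , adj) = un , (λ x → ins x ∘ there) , λ i j →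
      (λ a → map⊎ ℕ.suc-injective ℕ.suc-injective (proj₁ (adj (suc i) (suc j)) a))
    , (λ a → proj₂ (adj (suc i) (suc j)) (map⊎ (cong suc) (cong suc) a))

  ends-distinct : ∀ {x y e} → In (LK n) e → e ≈ (x , y) → x ≢ y
  ends-distinct e< (inj₁ (refl , refl)) refl = <-irrefl refl e<
  ends-distinct e< (inj₂ (refl , refl)) refl = <-irrefl refl e<

  -- Here `x` is the end of `e` left behind. The next edge misses `x`, so it meets `e` in `y`; the
  -- edges after it do not meet `e`, so they miss `y`, and the induction continues from there. Every
  -- later vertex lies on a later edge and thus differs from `x`.
  trace-from : ∀ {x y e} P → InducedPath (LK n) (e ∷ P) → e ≈ (x , y) → (∀ {f} → f ∈ P → ¬ On x f) →
    ∃ λ xs → Unique (x ∷ y ∷ xs) × Along (x ∷ y ∷ xs) (e ∷ P)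
  trace-from [] (_ , ins , _) e≈ _ =
    [] , (ends-distinct (ins _ (here refl)) e≈ ∷ []) ∷ [] ∷ [] , e≈ ∷ []
  trace-from (f ∷ P) ip e≈ x∉
    with other-end (meets-end e≈ (proj₂ (induced-adj ip)) (x∉ (here refl)))
  ... | z , f≈
    with trace-from P (induced-tail ip) f≈
           (λ g∈ on → induced-apart ip g∈ (on-both⇒Meets (≈-snd-on e≈) on))
  ... | xs , un , al = z ∷ xs , All.tabulate x≢ ∷ un , e≈ ∷ al
    where
    x≢ : ∀ {w} → w ∈ _ ∷ z ∷ xs → _ ≢ w
    x≢ w∈ refl with Along-on al w∈
    ... | g , g∈ , on = x∉ g∈ on

  -- The second edge decides the direction of the first: the trace starts at the end of `e` off `f`.
  -- Only one end is on `f`, since otherwise `e` and `f` would coincide.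
  induced-path-trace : ∀ e P → InducedPath (LK n) (e ∷ P) → ∃ λ xs → Unique xs × Along xs (e ∷ P)
  induced-path-trace e [] ip = _ , proj₂ (trace-from [] ip (inj₁ (refl , refl)) (λ ()))
  induced-path-trace e (f ∷ P) ip@(_ , ins , _) = start (proj₂ (induced-adj ip))
    where
    e≢f : e ≢ f
    e≢f = proj₁ (induced-adj ip)
    e-in : In (LK n) e
    e-in = ins e (here refl)
    f-in : In (LK n) f
    f-in = ins f (there (here refl))

    from-fst : On (proj₂ e) f → ∃ λ xs → Unique xs × Along xs (e ∷ f ∷ P)
    from-fst on = _ , proj₂ (trace-from (f ∷ P) ip (inj₁ (refl , refl)) λ
      { (here refl) on′ → e≢f (on-both⇒≡ e-in f-in on′ on)
      ; (there g∈)  on′ → induced-apart ip g∈ (on-both⇒Meets (inj₁ refl) on′) })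

    from-snd : On (proj₁ e) f → ∃ λ xs → Unique xs × Along xs (e ∷ f ∷ P)
    from-snd on = _ , proj₂ (trace-from (f ∷ P) ip (inj₂ (refl , refl)) λ
      { (here refl) on′ → e≢f (on-both⇒≡ e-in f-in on on′)
      ; (there g∈)  on′ → induced-apart ip g∈ (on-both⇒Meets (inj₂ refl) on′) })

    start : Meets e f → ∃ λ xs → Unique xs × Along xs (e ∷ f ∷ P)
    start (inj₁ p)        = from-snd (inj₁ p)
    start (inj₂ (inj₁ p)) = from-snd (inj₂ p)
    start (inj₂ (inj₂ q)) = from-fst q

-- Relabelling the vertices of the complete graph.

transpose-left : ∀ {n} (i j : Fin n) → transpose i j ⟨$⟩ʳ i ≡ j
transpose-left i j rewrite dec-true (i ≟ᶠ i) refl = refl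

transpose-other : ∀ {n} {i j k : Fin n} → k ≢ i → k ≢ j → transpose i j ⟨$⟩ʳ k ≡ k
transpose-other {i = i} {j} {k} k≢i k≢j
  rewrite dec-false (k ≟ᶠ i) k≢i | dec-false (k ≟ᶠ j) k≢j = refl

-- The bijection found for the tails is preceded by the transposition of `x` with the preimage of
-- `y`. This fixes all of `xs`, which contains neither: `x` by uniqueness, and the preimage because
-- `y` is not in the image `ys` of `xs`.
extend-to-bijection : ∀ {n} {W : Set} → Fin n ↔ W → ∀ {xs ys} → Unique xs → Unique ys → length xs ≡ length ys →
  ∃ λ (ρ : Fin n ↔ W) → mapᴸ (Inverse.to ρ) xs ≡ ys
extend-to-bijection π {[]} {[]} _ _ _ = π , refl
extend-to-bijection π {x ∷ xs} {y ∷ ys} (x∉ ∷ uxs) (y∉ ∷ uys) eq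
  with extend-to-bijection π uxs uys (ℕ.suc-injective eq)
... | ρ , refl = ρ ↔-∘ transpose x (from y) , cong₂ _∷_
  (trans (cong to (transpose-left x (from y))) (strictlyInverseˡ y))
  (map-cong-local (All.tabulate λ z∈ → cong to (transpose-other (≢-sym (All.lookup x∉ z∈))
    λ z≡ → All.lookup y∉ (∈-map⁺ to z∈) (trans (sym (strictlyInverseˡ y)) (cong to (sym z≡))))))
  where open Inverse ρ using (to; from; strictlyInverseˡ)

module _ {W : Set} {n k : ℕ} (K : LineKernel W k) (π : Fin n ↔ W) where

  open LineKernel K

  Uncoloured : W → W → Set
  Uncoloured u v = colour u v ≡ nothing

  uncoloured-along : ∀ (ρ : Fin n ↔ W) {xs P e} → Chain Uncoloured (mapᴸ (Inverse.to ρ) xs) → Along xs P → e ∈ P →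
    colour (Inverse.to ρ (proj₁ e)) (Inverse.to ρ (proj₂ e)) ≡ nothing
  uncoloured-along ρ (c , _) (inj₁ (refl , refl) ∷ _) (here refl) = c
  uncoloured-along ρ (c , _) (inj₂ (refl , refl) ∷ _) (here refl) = trans (colour-sym _ _) c
  uncoloured-along ρ (_ , c) (_ ∷ a) (there e∈) = uncoloured-along ρ c a e∈

  CISTs-full : HasCISTs (LK n) k
  CISTs-full = lineKernel⇒CISTs (pullback π K) (In (LK n)) (λ z → z) (λ z _ → z)

  -- Relabelling `xs` as `ys` makes every deleted edge uncoloured, so each of them is a leaf in all
  -- the trees.
  CISTs-minus : ∀ {ys xs P} → Unique ys → Chain Uncoloured ys → Unique xs → Along xs P → length xs ≡ length ys →
    HasCISTs (LK n ─ P) k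
  CISTs-minus {P = P} uys cys uxs al eq with extend-to-bijection π uxs uys eq
  ... | ρ , refl = lineKernel⇒CISTs (pullback ρ K) (In (LK n ─ P)) proj₁
    (λ e-in c → e-in , λ e∈ → just≢nothing (trans (sym c) (uncoloured-along ρ cys al e∈)))
    where
    just≢nothing : ∀ {i : Fin k} → just i ≢ nothing
    just≢nothing ()

-- The decomposition into double stars.

-- The decomposition of the complete graph on the vertices aᵢ = (i , false)
-- and bᵢ = (i , true) into double stars: star i consists of the edges joining
-- each vertex w to attach i w.

module DoubleStars (k : ℕ) where

  Z : Set
  Z = Fin k × Bool

  infix 4 _≟_

  _≟_ : DecidableEquality Z
  _≟_ = ≡-dec _≟ᶠ_ _≟ᵇ_

  open Min (≤-totalOrder k) using (_⊓_; ⊓-comm; ⊓-sel; x≤y⇒y⊓x≈x) public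
  open Max (≤-totalOrder k) using (_⊔_; ⊔-comm; ⊔-sel; x≤y⇒x⊔y≈y) public

  star : Z → Z → Fin k
  star (i , s) (j , t) = if s xor t then i ⊔ j else i ⊓ j

  -- The letter of the centre end to which a vertex is joined in star `i`. A centre end itself falls
  -- under the second case and is joined to its partner.
  side : Fin k → Z → Bool
  side i (j , t) with i <ᶠ? j
  ... | yes _ = t
  ... | no  _ = not t

  attach : Fin k → Z → Z
  attach i w = i , side i w

  star-sym : ∀ u v → star u v ≡ star v u
  star-sym (i , s) (j , t) rewrite xor-comm s t | ⊔-comm i j | ⊓-comm i j = refl

  star-meets : ∀ u v → proj₁ u ≡ star u v ⊎ proj₁ v ≡ star u v
  star-meets (i , s) (j , t) with s xor t
  ... | true  = [ inj₁ ∘ sym , inj₂ ∘ sym ]′ (⊔-sel i j)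
  ... | false = [ inj₁ ∘ sym , inj₂ ∘ sym ]′ (⊓-sel i j)

  side-< : ∀ {i j} t → toℕ i < toℕ j → side i (j , t) ≡ t
  side-< {i} {j} t i<j with i <ᶠ? j
  ... | yes _  = refl
  ... | no i≮j = ⊥-elim (i≮j i<j)

  side-≥ : ∀ {i j} t → toℕ j ≤ toℕ i → side i (j , t) ≡ not t
  side-≥ {i} {j} t j≤i with i <ᶠ? j
  ... | yes i<j = ⊥-elim (<⇒≱ i<j j≤i)
  ... | no  _   = refl

  star-attach : ∀ i w → star w (attach i w) ≡ i
  star-attach i (j , t) with i <ᶠ? j
  star-attach i (j , false) | yes i<j = x≤y⇒y⊓x≈x (<⇒≤ i<j)
  star-attach i (j , true)  | yes i<j = x≤y⇒y⊓x≈x (<⇒≤ i<j)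
  star-attach i (j , false) | no  i≮j = x≤y⇒x⊔y≈y (≮⇒≥ i≮j)
  star-attach i (j , true)  | no  i≮j = x≤y⇒x⊔y≈y (≮⇒≥ i≮j)

  attach-≢ : ∀ i w → w ≢ attach i w
  attach-≢ i (j , t) eq with i <ᶠ? j
  ... | yes i<j = <-irrefl (cong (toℕ ∘ proj₁) (sym eq)) i<j
  ... | no  _   = not-¬ refl (cong proj₂ eq)

  attach-own : ∀ i t → attach i (i , t) ≡ (i , not t)
  attach-own i t = cong (i ,_) (side-≥ {i} {i} t ≤-refl)

  meets-ends : ∀ {i} {u v : Z} → proj₁ u ≡ i ⊎ proj₁ v ≡ i → Meets (u , v) ((i , false) , (i , true))
  meets-ends {u = _ , false} (inj₁ refl) = inj₁ refl
  meets-ends {u = _ , true}  (inj₁ refl) = inj₂ (inj₁ refl)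
  meets-ends {v = _ , false} (inj₂ refl) = inj₂ (inj₂ (inj₁ refl))
  meets-ends {v = _ , true}  (inj₂ refl) = inj₂ (inj₂ (inj₂ refl))

-- Even order from six on.

chain-applyUpTo : ∀ {V : Set} {R : V → V → Set} (f : ℕ → V) m →
  (∀ t → suc t < m → R (f t) (f (suc t))) → Chain R (applyUpTo f m)
chain-applyUpTo f 0             r = tt
chain-applyUpTo f 1             r = tt
chain-applyUpTo f (suc (suc m)) r = r 0 (s≤s (s≤s z≤n)) , chain-applyUpTo (f ∘ suc) (suc m) (λ t → r (suc t) ∘ s≤s)

-- Removing from each double star its edge on the path spine, that is
-- a₀ a₁ … aₖ₋₁ b₀, leaves a tree missing only the vertex gap i.
module Even (m : ℕ) where

  k : ℕ
  k = 3 + m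

  open DoubleStars k

  spine : ℕ → Z
  spine t with t <? k
  ... | yes t<k = fromℕ< t<k , false
  ... | no  _   = zero , true

  -- The spine edge of star `i` joins aᵢ, which is `spine (toℕ i)`, to this vertex.
  gap : Fin k → Z
  gap i = spine (suc (toℕ i))

  -- Successor on the cycle of length `k`, which leads from the index of a star to the index of its
  -- gap. Asymmetry rests on `k` being at least 3.
  _↝_ : ℕ → ℕ → Set
  a ↝ b = b ≡ suc a ⊎ (b ≡ 0 × suc a ≡ k)

  ↝-irrefl : ∀ {a} → ¬ a ↝ a
  ↝-irrefl (inj₁ ())
  ↝-irrefl (inj₂ (refl , ()))

  ↝-asym : ∀ {a b} → a ↝ b → ¬ b ↝ a
  ↝-asym (inj₁ refl)       (inj₁ ())
  ↝-asym (inj₁ refl)       (inj₂ (refl , ()))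
  ↝-asym (inj₂ (refl , ())) (inj₁ refl)
  ↝-asym (inj₂ (refl , _)) (inj₂ (refl , ()))

  gap-cases : ∀ i → (toℕ (proj₁ (gap i)) ≡ suc (toℕ i) × proj₂ (gap i) ≡ false)
                  ⊎ (gap i ≡ (zero , true) × suc (toℕ i) ≡ k)
  gap-cases i with suc (toℕ i) <? k
  ... | yes p = inj₁ (toℕ-fromℕ< p , refl)
  ... | no ¬p = inj₂ (refl , ≤-antisym (toℕ<n i) (≮⇒≥ ¬p))

  gap-↝ : ∀ i → toℕ i ↝ toℕ (proj₁ (gap i))
  gap-↝ i with gap-cases i
  ... | inj₁ (p , _) = inj₁ p
  ... | inj₂ (p , q) = inj₂ (cong (toℕ ∘ proj₁) p , q)

  gap-≢ : ∀ i → proj₁ (gap i) ≢ i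
  gap-≢ i eq = ↝-irrefl (subst (λ j → toℕ i ↝ toℕ j) eq (gap-↝ i))

  gap-asym : ∀ i {j} → proj₁ (gap i) ≡ j → proj₁ (gap j) ≢ i
  gap-asym i {j} refl eq = ↝-asym (gap-↝ i) (subst (λ l → toℕ j ↝ toℕ l) eq (gap-↝ j))

  attach-gap : ∀ i → attach i (gap i) ≡ (i , false)
  attach-gap i with gap i | gap-cases i
  ... | j , .false     | inj₁ (p , refl) = cong (i ,_) (side-< {i} {j} false (subst (toℕ i <_) (sym p) ≤-refl))
  ... | .(zero , true) | inj₂ (refl , _) = cong (i ,_) (side-≥ {i} {zero} true z≤n)

  -- The edge from aᵢ to the gap belongs to star `i` itself, so another star can join the gap only
  -- to bᵢ.
  attach≡gap⇒b : ∀ i j t → attach j (i , t) ≡ gap i → t ≡ true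
  attach≡gap⇒b i j true  _  = refl
  attach≡gap⇒b i j false eq with gap-cases i
  ... | inj₁ (p , q) = trans (sym q) (trans (cong proj₂ (sym eq)) (side-≥ {j} {i} false
          (subst (toℕ i ≤_) (sym (trans (cong (toℕ ∘ proj₁) eq) p)) (n≤1+n _))))
  ... | inj₂ (p , q) = trans (sym (side-< {j} {i} false
          (subst₂ _<_ (sym (cong (toℕ ∘ proj₁) (trans eq p))) (sym (cong pred q)) (s≤s z≤n))))
          (cong proj₂ (trans eq p))

  -- The gap is pendant in star `i`, so uncolouring the edges of the star at the gap uncolours
  -- exactly its spine edge.
  keep : Z → Z → Fin k → Maybe (Fin k)
  keep u v i with u ≟ gap i | v ≟ gap i
  ... | no _  | no _  = just i
  ... | yes _ | _     = nothing
  ... | no _  | yes _ = nothing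

  keep-sym : ∀ u v i → keep u v i ≡ keep v u i
  keep-sym u v i with u ≟ gap i | v ≟ gap i
  ... | no _  | no _  = refl
  ... | yes _ | yes _ = refl
  ... | yes _ | no _  = refl
  ... | no _  | yes _ = refl

  keep-just : ∀ {u v i j} → keep u v i ≡ just j → i ≡ j
  keep-just {u} {v} {i} with u ≟ gap i | v ≟ gap i
  ... | no _  | no _  = Maybe.just-injective
  ... | yes _ | _     = λ ()
  ... | no _  | yes _ = λ ()

  keep-inside : ∀ {u v i} → u ≢ gap i → v ≢ gap i → keep u v i ≡ just i
  keep-inside {u} {v} {i} u≢ v≢ with u ≟ gap i | v ≟ gap i
  ... | no _  | no _  = refl
  ... | yes p | _     = ⊥-elim (u≢ p)
  ... | no _  | yes p = ⊥-elim (v≢ p)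

  keep-gap : ∀ u i → keep u (gap i) i ≡ nothing
  keep-gap u i with u ≟ gap i | gap i ≟ gap i
  ... | yes _ | _     = refl
  ... | no _  | yes _ = refl
  ... | no _  | no ¬p = ⊥-elim (¬p refl)

  colour : Z → Z → Maybe (Fin k)
  colour u v = keep u v (star u v)

  colour-sym : ∀ u v → colour u v ≡ colour v u
  colour-sym u v = trans (keep-sym u v (star u v)) (cong (keep v u) (star-sym u v))

  colour-attach : ∀ i {w} → w ≢ gap i → colour w (attach i w) ≡ just i
  colour-attach i {w} w≢ = trans (cong (keep w (attach i w)) (star-attach i w))
    (keep-inside w≢ (gap-≢ i ∘ sym ∘ cong proj₁))

  colour-gap : ∀ i → colour (i , false) (gap i) ≡ nothing
  colour-gap i = trans (cong (keep (i , false) (gap i)) own) (keep-gap (i , false) i)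
    where
    own : star (i , false) (gap i) ≡ i
    own = trans (cong (λ u → star u (gap i)) (sym (attach-gap i)))
            (trans (star-sym (attach i (gap i)) (gap i)) (star-attach i (gap i)))

  -- An edge of star `j` is attached at its centre end unless that is the gap of star `i`; on the
  -- centre edge aⱼ comes before bⱼ.
  priority : Fin k → Fin k → Z → ℕ
  priority i j w with w ≟ gap i | proj₁ w ≟ᶠ j
  ... | yes _ | _     = 3
  ... | no  _ | yes _ = if proj₂ w then 1 else 0
  ... | no  _ | no  _ = 2

  priority<3 : ∀ i j {w} → w ≢ gap i → priority i j w < 3
  priority<3 i j {w} w≢ with w ≟ gap i | proj₁ w ≟ᶠ j
  ... | yes p | _     = ⊥-elim (w≢ p)
  ... | no  _ | no  _ = ≤-refl
  priority<3 i j {_ , true}  w≢ | no _ | yes _ = s≤s (s≤s z≤n)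
  priority<3 i j {_ , false} w≢ | no _ | yes _ = s≤s z≤n

  priority-gap : ∀ i j → priority i j (gap i) ≡ 3
  priority-gap i j with gap i ≟ gap i | proj₁ (gap i) ≟ᶠ j
  ... | yes _ | _ = refl
  ... | no ¬p | _ = ⊥-elim (¬p refl)

  priority-outer : ∀ i j {w} → w ≢ gap i → proj₁ w ≢ j → priority i j w ≡ 2
  priority-outer i j {w} w≢ ≢j with w ≟ gap i | proj₁ w ≟ᶠ j
  ... | yes p | _     = ⊥-elim (w≢ p)
  ... | no  _ | yes p = ⊥-elim (≢j p)
  ... | no  _ | no  _ = refl

  priority-own : ∀ i j t → (j , t) ≢ gap i → priority i j (j , t) ≡ (if t then 1 else 0)
  priority-own i j t w≢ with (j , t) ≟ gap i | j ≟ᶠ j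
  ... | yes p | _     = ⊥-elim (w≢ p)
  ... | no  _ | yes _ = refl
  ... | no  _ | no ¬p = ⊥-elim (¬p refl)

  priority-own<2 : ∀ i j t → (j , t) ≢ gap i → priority i j (j , t) < 2
  priority-own<2 i j true  w≢ = subst (_< 2) (sym (priority-own i j true w≢)) (s≤s (s≤s z≤n))
  priority-own<2 i j false w≢ = subst (_< 2) (sym (priority-own i j false w≢)) (s≤s z≤n)

  attach-decreasing : ∀ i j s → s ≢ gap i → proj₁ s ≢ j → attach j s ≢ gap i →
    priority i j (attach j s) < priority i j s
  attach-decreasing i j s s≢ ≢j a≢ =
    subst (priority i j (attach j s) <_) (sym (priority-outer i j s≢ ≢j)) (priority-own<2 i j (side j s) a≢)

  -- Star `j` leads `s` to its centre, where the priority is lower, unless it arrives at `gap i`.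
  -- Then `gap-asym` keeps star `i` from leading `s` to `gap j`, and the exchanged argument works if
  -- `s` is off centre `i`. If `s` is on it, then `s` is bᵢ and the priority falls from 1 to 0 on
  -- the way to aᵢ.
  decreasing-outside : ∀ i j s → s ≢ gap i → s ≢ gap j → proj₁ s ≢ j →
    priority i j (attach j s) < priority i j s ⊎ priority j i (attach i s) < priority j i s
  decreasing-outside i j s@(l , t) s≢i s≢j ≢j = go (attach j s ≟ gap i) (l ≟ᶠ i)
    where
    Goal : Set
    Goal = priority i j (attach j s) < priority i j s ⊎ priority j i (attach i s) < priority j i s

    go : Dec (attach j s ≡ gap i) → Dec (l ≡ i) → Goal
    go (no a≢) _ = inj₁ (attach-decreasing i j s s≢i ≢j a≢)
    go (yes a≡) (no l≢i) = inj₂ (attach-decreasing j i s s≢j l≢i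
      (gap-asym i (cong proj₁ (sym a≡)) ∘ cong proj₁ ∘ sym))
    go (yes a≡) (yes refl) = inj₂ (subst₂ _<_ (sym before) (sym after) (s≤s z≤n))
      where
      t≡true : t ≡ true
      t≡true = attach≡gap⇒b i j t a≡
      before : priority j i (attach i s) ≡ 0
      before = trans (cong (priority j i) (trans (attach-own i t) (cong (λ b → i , not b) t≡true)))
        (priority-own j i false (gap-asym i (cong proj₁ (sym a≡)) ∘ cong proj₁ ∘ sym))
      after : priority j i s ≡ 1
      after = trans (priority-own j i t s≢j) (cong (if_then 1 else 0) t≡true)

  decreasing : ∀ {i j} s → i ≢ j → s ≢ gap i → s ≢ gap j →
    priority i j (attach j s) < priority i j s ⊎ priority j i (attach i s) < priority j i s
  decreasing {i} {j} s i≢j s≢i s≢j = go (proj₁ s ≟ᶠ j)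
    where
    go : Dec (proj₁ s ≡ j) → priority i j (attach j s) < priority i j s ⊎ priority j i (attach i s) < priority j i s
    go (no  s≢) = decreasing-outside i j s s≢i s≢j s≢
    -- A vertex of centre `j` is not on centre `i`, so the roles are exchanged.
    go (yes s≡) = swap (decreasing-outside j i s s≢j s≢i (i≢j ∘ sym ∘ trans (sym s≡)))

  kernel : PriorityKernel Z k
  kernel = record
    { classes = record
      { colour        = colour
      ; centre        = λ i → (i , false) , (i , true)
      ; colour-sym    = colour-sym
      ; centre-≢      = λ _ ()
      ; centre-colour = λ i → subst (λ w → colour (i , false) w ≡ just i) (attach-own i false)
                                (colour-attach i (gap-≢ i ∘ sym ∘ cong proj₁))
      ; centre-meets  = λ {_} {u} {v} c → subst (λ i → Meets (u , v) ((i , false) , (i , true)))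
                                            (keep-just {u} {v} c) (meets-ends (star-meets u v))
      }
    ; gap        = gap
    ; nb         = λ i _ → attach i
    ; priority   = priority
    ; nb-≢       = λ i _ _ → attach-≢ i _
    ; nb-colour  = λ i _ → colour-attach i
    ; gap-last   = λ i j {w} w≢ → subst (priority i j w <_) (sym (priority-gap i j)) (priority<3 i j w≢)
    ; decreasing = decreasing
    }

  spine-a : ∀ {t} (t<k : t < k) → spine t ≡ (fromℕ< t<k , false)
  spine-a {t} t<k with t <? k
  ... | yes _  = refl
  ... | no ¬p = ⊥-elim (¬p t<k)

  spine-uncoloured : ∀ {t} → t < k → colour (spine t) (spine (suc t)) ≡ nothing
  spine-uncoloured t<k = subst₂ (λ u s → colour u (spine (suc s)) ≡ nothing)
    (sym (spine-a t<k)) (toℕ-fromℕ< t<k) (colour-gap (fromℕ< t<k))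

  spine-≢ : ∀ {s t} → s < t → t ≤ k → spine s ≢ spine t
  spine-≢ {s} {t} s<t t≤k eq with trans (sym (spine-a (≤-trans s<t t≤k))) eq
  ... | eq′ with t <? k
  ...   | yes t<k = <-irrefl (trans (sym (toℕ-fromℕ< _)) (trans (cong (toℕ ∘ proj₁) eq′) (toℕ-fromℕ< t<k))) s<t
  ...   | no  _ with cong proj₂ eq′
  ...     | ()

-- Odd order from seven on.

-- The double stars on 2h vertices and, with colour zero, the star of an
-- additional vertex ∞ = nothing, modified as follows: a₀a₁ moves from double
-- star 0 to the star of ∞, ∞b₀ moves to double star 0, and ∞a₁ is left
-- uncoloured.
module Odd (m : ℕ) where

  h : ℕ
  h = 3 + m

  open DoubleStars h

  W : Set
  W = Maybe Z

  pattern ∞  = nothing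
  pattern a₀ = zero , false
  pattern b₀ = zero , true
  pattern a₁ = suc zero , false
  pattern b₁ = suc zero , true
  pattern a₂ = suc (suc zero) , false

  IsA₀A₁ : Z → Z → Set
  IsA₀A₁ y z = (y ≡ a₀ × z ≡ a₁) ⊎ (y ≡ a₁ × z ≡ a₀)

  isA₀A₁? : ∀ y z → Dec (IsA₀A₁ y z)
  isA₀A₁? y z = (y ≟ a₀ ×-dec z ≟ a₁) ⊎-dec (y ≟ a₁ ×-dec z ≟ a₀)

  IsA₀A₁-sym : ∀ {y z} → IsA₀A₁ y z → IsA₀A₁ z y
  IsA₀A₁-sym (inj₁ (p , q)) = inj₂ (q , p)
  IsA₀A₁-sym (inj₂ (p , q)) = inj₁ (q , p)

  spoke : Z → Maybe (Fin (suc h))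
  spoke b₀ = just (suc zero)
  spoke a₁ = nothing
  spoke _  = just zero

  rim : Z → Z → Maybe (Fin (suc h))
  rim y z with isA₀A₁? y z
  ... | yes _ = just zero
  ... | no  _ = just (suc (star y z))

  colour : W → W → Maybe (Fin (suc h))
  colour ∞        ∞        = nothing
  colour ∞        (just z) = spoke z
  colour (just z) ∞        = spoke z
  colour (just y) (just z) = rim y z

  rim-star : ∀ {y z} → ¬ IsA₀A₁ y z → rim y z ≡ just (suc (star y z))
  rim-star {y} {z} ¬s with isA₀A₁? y z
  ... | yes s = ⊥-elim (¬s s)
  ... | no  _ = refl

  rim-sym : ∀ y z → rim y z ≡ rim z y
  rim-sym y z with isA₀A₁? y z | isA₀A₁? z y
  ... | yes _ | yes _ = refl
  ... | no  _ | no  _ = cong (just ∘ suc) (star-sym y z)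
  ... | yes s | no ¬s = ⊥-elim (¬s (IsA₀A₁-sym s))
  ... | no ¬s | yes s = ⊥-elim (¬s (IsA₀A₁-sym s))

  colour-sym : ∀ u v → colour u v ≡ colour v u
  colour-sym ∞        ∞        = refl
  colour-sym ∞        (just z) = refl
  colour-sym (just z) ∞        = refl
  colour-sym (just y) (just z) = rim-sym y z

  ¬A₀A₁-attach-suc : ∀ i z → ¬ IsA₀A₁ z (attach (suc i) z)
  ¬A₀A₁-attach-suc i z (inj₁ (refl , q)) with trans (sym (side-≥ {suc i} {zero} false z≤n)) (cong proj₂ q)
  ... | ()
  ¬A₀A₁-attach-suc i z (inj₂ (_ , q)) with cong proj₁ q
  ... | ()

  ¬A₀A₁-attach-zero : ∀ {z} → z ≢ a₁ → ¬ IsA₀A₁ z (attach zero z)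
  ¬A₀A₁-attach-zero z≢ (inj₁ (_ , q)) with cong proj₁ q
  ... | ()
  ¬A₀A₁-attach-zero z≢ (inj₂ (p , _)) = z≢ p

  rim-attach : ∀ i {z} → ¬ IsA₀A₁ z (attach i z) → rim z (attach i z) ≡ just (suc i)
  rim-attach i {z} ¬s = trans (rim-star ¬s) (cong (just ∘ suc) (star-attach i z))

  attach-a₀ : ∀ i → attach (suc i) a₀ ≡ (suc i , true)
  attach-a₀ i = cong (suc i ,_) (side-≥ {suc i} {zero} false z≤n)

  centre : Fin (suc h) → W × W
  centre zero    = ∞ , just a₀
  centre (suc i) = just (i , false) , just (i , true)

  centre-≢ : ∀ i → proj₁ (centre i) ≢ proj₂ (centre i)
  centre-≢ zero    ()
  centre-≢ (suc i) ()

  centre-colour : ∀ i → colour (proj₁ (centre i)) (proj₂ (centre i)) ≡ just i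
  centre-colour zero    = refl
  centre-colour (suc i) = trans (rim-star (λ { (inj₁ (_ , ())) ; (inj₂ (_ , ())) }))
    (cong (just ∘ suc) (trans (cong (star (i , false)) (sym (attach-own i false))) (star-attach i (i , false))))

  spoke-meets : ∀ z {i} → spoke z ≡ just i → Meets (∞ , just z) (centre i)
  spoke-meets z  {zero} _ = inj₁ refl
  spoke-meets b₀ {suc _} refl = inj₂ (inj₂ (inj₂ refl))
  spoke-meets a₀ {suc _} ()
  spoke-meets a₁ {suc _} ()
  spoke-meets b₁ {suc _} ()
  spoke-meets (suc (suc _) , _) {suc _} ()

  Meets-just : ∀ {y z s t : Z} → Meets (y , z) (s , t) → Meets (just y , just z) (just s , just t)
  Meets-just (inj₁ p)               = inj₁ (cong just p)
  Meets-just (inj₂ (inj₁ p))        = inj₂ (inj₁ (cong just p))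
  Meets-just (inj₂ (inj₂ (inj₁ p))) = inj₂ (inj₂ (inj₁ (cong just p)))
  Meets-just (inj₂ (inj₂ (inj₂ p))) = inj₂ (inj₂ (inj₂ (cong just p)))

  centre-meets : ∀ {i u v} → colour u v ≡ just i → Meets (u , v) (centre i)
  centre-meets {u = ∞}      {just z} c = spoke-meets z c
  centre-meets {u = just z} {∞}      c with spoke-meets z c
  ... | inj₁ p                = inj₂ (inj₂ (inj₁ p))
  ... | inj₂ (inj₁ p)         = inj₂ (inj₂ (inj₂ p))
  ... | inj₂ (inj₂ (inj₁ p))  = inj₁ p
  ... | inj₂ (inj₂ (inj₂ p))  = inj₂ (inj₁ p)
  centre-meets {u = just y} {just z} c with isA₀A₁? y z
  centre-meets {u = just y} {just z} refl | yes (inj₁ (refl , _)) = inj₂ (inj₁ refl)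
  centre-meets {u = just y} {just z} refl | yes (inj₂ (_ , refl)) = inj₂ (inj₂ (inj₂ refl))
  centre-meets {u = just y} {just z} refl | no  _ = Meets-just (meets-ends (star-meets y z))

  -- The star of ∞ reaches a₁ through a₀ but has lost b₀; double star 0 has lost a₁ but reaches ∞
  -- through b₀; the other double stars do not contain ∞.
  gap : Fin (suc h) → W
  gap zero          = just b₀
  gap (suc zero)    = just a₁
  gap (suc (suc _)) = ∞

  nb : Fin (suc h) → Fin (suc h) → W → W
  nb zero          _ ∞         = just a₀
  nb zero          _ (just a₁) = just a₀
  -- Against the later double stars a₀ avoids ∞, which is their gap.
  nb zero          (suc (suc j)) (just a₀) = just a₁
  nb zero          _ (just z)  = ∞
  nb (suc zero)    _ ∞         = just b₀
  -- The partner b₀ is the gap of class `zero`, hence the pendant vertex a₂.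
  nb (suc zero)    zero (just a₀) = just a₂
  nb (suc zero)    _ (just z)  = just (attach zero z)
  nb (suc (suc i)) _ ∞         = ∞
  -- Along the centre edge the priority can fall in one direction only, so its b-end turns to a₀.
  nb (suc (suc i)) zero (just (suc l , true)) with l ≟ᶠ i
  ... | yes _ = just a₀
  ... | no  _ = just (attach (suc i) (suc l , true))
  nb (suc (suc i)) _ (just z)  = just (attach (suc i) z)

  own : Fin h → Z → ℕ
  own j (l , t) with l ≟ᶠ j
  ... | yes _ = if t then 1 else 0
  ... | no  _ = 2

  own-outer : ∀ {j z} → proj₁ z ≢ j → own j z ≡ 2
  own-outer {j} {l , t} ≢j with l ≟ᶠ j
  ... | yes p = ⊥-elim (≢j p)
  ... | no  _ = refl

  own-inner : ∀ j t → own j (j , t) < 2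
  own-inner j t with j ≟ᶠ j
  ... | no ¬p = ⊥-elim (¬p refl)
  own-inner j false | yes _ = s≤s z≤n
  own-inner j true  | yes _ = s≤s (s≤s z≤n)

  own<3 : ∀ j z → own j z < 3
  own<3 j (l , t) with l ≟ᶠ j
  own<3 j (l , t)     | no  _ = ≤-refl
  own<3 j (l , true)  | yes _ = s≤s (s≤s z≤n)
  own<3 j (l , false) | yes _ = s≤s z≤n

  own-attach : ∀ j {z} → proj₁ z ≢ j → own j (attach j z) < own j z
  own-attach j {z} ≢j = subst (own j (attach j z) <_) (sym (own-outer {j} {z} ≢j)) (own-inner j (side j z))

  -- Between double stars `own` is followed as in the even case, apart from the places of ∞ and the
  -- gaps. The values involving class `zero` are fitted to the exceptional neighbours above.
  priority : Fin (suc h) → Fin (suc h) → W → ℕ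
  priority zero zero (just b₀) = 1
  priority zero zero _         = 0
  priority zero (suc zero) (just b₀) = 3
  priority zero (suc zero) (just a₀) = 2
  priority zero (suc zero) _         = 1
  priority zero (suc (suc j)) ∞         = 3
  priority zero (suc (suc j)) (just b₀) = 4
  priority zero (suc (suc j)) (just a₀) = 0
  priority zero (suc (suc j)) (just (suc l , t)) with l ≟ᶠ j
  ... | yes _ = if t then 1 else 2
  ... | no  _ = 3
  priority (suc zero) zero ∞         = 1
  priority (suc zero) zero (just a₀) = 0
  priority (suc zero) zero (just a₁) = 3
  priority (suc zero) zero _         = 2
  priority (suc zero) (suc j) ∞         = 2
  priority (suc zero) (suc j) (just a₁) = 3
  priority (suc zero) (suc j) (just z)  = own j z
  priority (suc (suc i)) zero ∞         = 2
  priority (suc (suc i)) zero (just a₁) = 0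
  priority (suc (suc i)) zero (just _)  = 1
  priority (suc (suc i)) (suc j) ∞        = 3
  priority (suc (suc i)) (suc j) (just z) = own j z

  attach-just-≢ : ∀ i z → just z ≢ just (attach i z)
  attach-just-≢ i z = attach-≢ i z ∘ Maybe.just-injective

  nb-≢ : ∀ i j {w} → w ≢ gap i → w ≢ nb i j w
  nb-≢ zero _ {∞} _ ()
  nb-≢ zero _ {just a₁} _ ()
  nb-≢ zero zero {just a₀} _ ()
  nb-≢ zero (suc zero) {just a₀} _ ()
  nb-≢ zero (suc (suc j)) {just a₀} _ ()
  nb-≢ zero _ {just b₀} w≢ _ = w≢ refl
  nb-≢ zero _ {just b₁} _ ()
  nb-≢ zero _ {just (suc (suc _) , _)} _ ()
  nb-≢ (suc zero) _ {∞} _ ()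
  nb-≢ (suc zero) zero {just a₀} _ ()
  nb-≢ (suc zero) zero {just b₀} _ = attach-just-≢ zero b₀
  nb-≢ (suc zero) zero {just z@(suc _ , _)} _ = attach-just-≢ zero z
  nb-≢ (suc zero) (suc _) {just z} _ = attach-just-≢ zero z
  nb-≢ (suc (suc i)) _ {∞} w≢ _ = w≢ refl
  nb-≢ (suc (suc i)) zero {just (suc l , true)} _ eq with l ≟ᶠ i
  nb-≢ (suc (suc i)) zero {just (suc l , true)} _ () | yes _
  ... | no _ = attach-just-≢ (suc i) (suc l , true) eq
  nb-≢ (suc (suc i)) zero {just z@(suc _ , false)} _ = attach-just-≢ (suc i) z
  nb-≢ (suc (suc i)) zero {just z@(zero , _)} _ = attach-just-≢ (suc i) z
  nb-≢ (suc (suc i)) (suc _) {just z} _ = attach-just-≢ (suc i) z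

  attach-colour-zero : ∀ {z} → just z ≢ gap (suc zero) → rim z (attach zero z) ≡ just (suc zero)
  attach-colour-zero z≢ = rim-attach zero (¬A₀A₁-attach-zero (z≢ ∘ cong just))

  attach-colour-suc : ∀ i z → rim z (attach (suc i) z) ≡ just (suc (suc i))
  attach-colour-suc i z = rim-attach (suc i) (¬A₀A₁-attach-suc i z)

  nb-colour : ∀ i j {w} → w ≢ gap i → colour w (nb i j w) ≡ just i
  nb-colour zero _ {∞} _ = refl
  nb-colour zero _ {just a₁} _ = refl
  nb-colour zero zero {just a₀} _ = refl
  nb-colour zero (suc zero) {just a₀} _ = refl
  nb-colour zero (suc (suc j)) {just a₀} _ = refl
  nb-colour zero _ {just b₀} w≢ = ⊥-elim (w≢ refl)
  nb-colour zero _ {just b₁} _ = refl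
  nb-colour zero _ {just (suc (suc _) , _)} _ = refl
  nb-colour (suc zero) _ {∞} _ = refl
  nb-colour (suc zero) zero {just a₀} _ = refl
  nb-colour (suc zero) zero {just b₀} w≢ = attach-colour-zero w≢
  nb-colour (suc zero) zero {just (suc _ , _)} w≢ = attach-colour-zero w≢
  nb-colour (suc zero) (suc _) {just z} w≢ = attach-colour-zero w≢
  nb-colour (suc (suc i)) _ {∞} w≢ = ⊥-elim (w≢ refl)
  nb-colour (suc (suc i)) zero {just (suc l , true)} _ with l ≟ᶠ i
  ... | yes refl = trans (rim-sym (suc i , true) a₀)
                     (trans (cong (rim a₀) (sym (attach-a₀ i))) (attach-colour-suc i a₀))
  ... | no _ = attach-colour-suc i (suc l , true)
  nb-colour (suc (suc i)) zero {just z@(suc _ , false)} _ = attach-colour-suc i z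
  nb-colour (suc (suc i)) zero {just z@(zero , _)} _ = attach-colour-suc i z
  nb-colour (suc (suc i)) (suc _) {just z} _ = attach-colour-suc i z

  gap-last : ∀ i j {w} → w ≢ gap i → priority i j w < priority i j (gap i)
  gap-last zero zero {∞} _ = s≤s z≤n
  gap-last zero zero {just a₀} _ = s≤s z≤n
  gap-last zero zero {just b₀} w≢ = ⊥-elim (w≢ refl)
  gap-last zero zero {just (suc _ , _)} _ = s≤s z≤n
  gap-last zero (suc zero) {∞} _ = s≤s (s≤s z≤n)
  gap-last zero (suc zero) {just a₀} _ = ≤-refl
  gap-last zero (suc zero) {just b₀} w≢ = ⊥-elim (w≢ refl)
  gap-last zero (suc zero) {just (suc _ , _)} _ = s≤s (s≤s z≤n)
  gap-last zero (suc (suc j)) {∞} _ = ≤-refl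
  gap-last zero (suc (suc j)) {just a₀} _ = s≤s z≤n
  gap-last zero (suc (suc j)) {just b₀} w≢ = ⊥-elim (w≢ refl)
  gap-last zero (suc (suc j)) {just (suc l , t)} _ with l ≟ᶠ j | t
  ... | no _  | _     = ≤-refl
  ... | yes _ | true  = s≤s (s≤s z≤n)
  ... | yes _ | false = s≤s (s≤s (s≤s z≤n))
  gap-last (suc zero) zero {∞} _ = s≤s (s≤s z≤n)
  gap-last (suc zero) zero {just a₀} _ = s≤s z≤n
  gap-last (suc zero) zero {just b₀} _ = ≤-refl
  gap-last (suc zero) zero {just a₁} w≢ = ⊥-elim (w≢ refl)
  gap-last (suc zero) zero {just b₁} _ = ≤-refl
  gap-last (suc zero) zero {just (suc (suc _) , _)} _ = ≤-refl
  gap-last (suc zero) (suc j) {∞} _ = ≤-refl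
  gap-last (suc zero) (suc j) {just a₁} w≢ = ⊥-elim (w≢ refl)
  gap-last (suc zero) (suc j) {just b₁} _ = own<3 j b₁
  gap-last (suc zero) (suc j) {just z@(zero , _)} _ = own<3 j z
  gap-last (suc zero) (suc j) {just z@(suc (suc _) , _)} _ = own<3 j z
  gap-last (suc (suc i)) zero {∞} w≢ = ⊥-elim (w≢ refl)
  gap-last (suc (suc i)) zero {just a₁} _ = s≤s z≤n
  gap-last (suc (suc i)) zero {just b₁} _ = ≤-refl
  gap-last (suc (suc i)) zero {just (zero , _)} _ = ≤-refl
  gap-last (suc (suc i)) zero {just (suc (suc _) , _)} _ = ≤-refl
  gap-last (suc (suc i)) (suc j) {∞} w≢ = ⊥-elim (w≢ refl)
  gap-last (suc (suc i)) (suc j) {just z} _ = own<3 j z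

  Decreases : Fin (suc h) → Fin (suc h) → W → Set
  Decreases i j s = priority i j (nb j i s) < priority i j s ⊎ priority j i (nb i j s) < priority j i s

  -- Class `zero` leads ∞ to a₀ and the other vertices considered, except a₀, to ∞, with falling
  -- priority for double star 0. At a₀ the detour to a₂ serves.
  decreasing-∞0 : ∀ s → s ≢ gap zero → s ≢ gap (suc zero) → Decreases zero (suc zero) s
  decreasing-∞0 ∞ _ _ = inj₂ (s≤s z≤n)
  decreasing-∞0 (just a₀) _ _ = inj₁ (s≤s (s≤s z≤n))
  decreasing-∞0 (just b₀) s≢ _ = ⊥-elim (s≢ refl)
  decreasing-∞0 (just a₁) _ s≢ = ⊥-elim (s≢ refl)
  decreasing-∞0 (just b₁) _ _ = inj₂ (s≤s (s≤s z≤n))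
  decreasing-∞0 (just (suc (suc _) , _)) _ _ = inj₂ (s≤s (s≤s z≤n))

  -- Double star `suc j` leads outer vertices (3) to its centre, the a-end (2) to the b-end (1), and
  -- this to a₀ (0). For a₀ itself the edge to a₁ in class `zero` serves.
  decreasing-∞j : ∀ j s → s ≢ gap zero → s ≢ ∞ → Decreases zero (suc (suc j)) s
  decreasing-∞j j ∞ _ s≢ = ⊥-elim (s≢ refl)
  decreasing-∞j j (just b₀) s≢ _ = ⊥-elim (s≢ refl)
  decreasing-∞j j (just a₀) _ _ = inj₂ (s≤s z≤n)
  decreasing-∞j j (just (suc l , t)) _ _ = inj₁ (descend l t)
    where
    inner≤2 : ∀ t → priority zero (suc (suc j)) (just (suc j , t)) < 3
    inner≤2 t with j ≟ᶠ j | t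
    ... | yes _ | true  = s≤s (s≤s z≤n)
    ... | yes _ | false = ≤-refl
    ... | no ¬p | _     = ⊥-elim (¬p refl)

    b-is-1 : priority zero (suc (suc j)) (just (suc j , true)) ≡ 1
    b-is-1 with j ≟ᶠ j
    ... | yes _ = refl
    ... | no ¬p = ⊥-elim (¬p refl)

    descend : ∀ l t → priority zero (suc (suc j)) (nb (suc (suc j)) zero (just (suc l , t)))
                        < priority zero (suc (suc j)) (just (suc l , t))
    descend l true with l ≟ᶠ j
    ... | yes _ = s≤s z≤n
    ... | no  _ = inner≤2 _
    descend l false with l ≟ᶠ j
    ... | yes refl = subst (_< 2) (sym (trans (cong (priority zero (suc (suc j)) ∘ just) (attach-own (suc j) false)) b-is-1))
                       (s≤s (s≤s z≤n))
    ... | no  _ = inner≤2 _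

  -- Double star 0 leads outer vertices to its centre and b₀ to a₀. The remaining a₀ moves in the
  -- other star to a b-end, which is not the gap a₁.
  decreasing-0j : ∀ j s → s ≢ gap (suc zero) → s ≢ ∞ → Decreases (suc zero) (suc (suc j)) s
  decreasing-0j j ∞ _ s≢ = ⊥-elim (s≢ refl)
  decreasing-0j j (just a₀) _ _ = inj₁ (subst (λ w → priority (suc zero) (suc (suc j)) (just w) < 2) (sym (attach-a₀ j))
                                    (b-inner j))
    where
    b-inner : ∀ j → priority (suc zero) (suc (suc j)) (just (suc j , true)) < 2
    b-inner zero    = own-inner (suc zero) true
    b-inner (suc j) = own-inner (suc (suc j)) true
  decreasing-0j j (just b₀) _ _ = inj₂ (s≤s z≤n)
  decreasing-0j j (just z@(suc _ , _)) _ _ = inj₂ (own-attach zero {z} λ ())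

  decreasing-ij : ∀ {i j} s → i ≢ j → s ≢ ∞ → Decreases (suc (suc i)) (suc (suc j)) s
  decreasing-ij ∞ _ s≢ = ⊥-elim (s≢ refl)
  decreasing-ij {i} {j} (just z) i≢j _ = go (proj₁ z ≟ᶠ suc j)
    where
    go : Dec (proj₁ z ≡ suc j) → Decreases (suc (suc i)) (suc (suc j)) (just z)
    go (no  z≢) = inj₁ (own-attach (suc j) {z} z≢)
    go (yes z≡) = inj₂ (own-attach (suc i) {z} λ z≡′ → i≢j (suc-injective (trans (sym z≡′) z≡)))

  decreasing : ∀ {i j} s → i ≢ j → s ≢ gap i → s ≢ gap j → Decreases i j s
  decreasing {zero}          {zero}          s i≢j _ _ = ⊥-elim (i≢j refl)
  decreasing {suc zero}      {suc zero}      s i≢j _ _ = ⊥-elim (i≢j refl)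
  decreasing {zero}          {suc zero}      s _ p q = decreasing-∞0 s p q
  decreasing {suc zero}      {zero}          s _ p q = swap (decreasing-∞0 s q p)
  decreasing {zero}          {suc (suc j)}   s _ p q = decreasing-∞j j s p q
  decreasing {suc (suc i)}   {zero}          s _ p q = swap (decreasing-∞j i s q p)
  decreasing {suc zero}      {suc (suc j)}   s _ p q = decreasing-0j j s p q
  decreasing {suc (suc i)}   {suc zero}      s _ p q = swap (decreasing-0j i s q p)
  decreasing {suc (suc i)}   {suc (suc j)}   s i≢j p _ = decreasing-ij s (λ i≡j → i≢j (cong (λ l → suc (suc l)) i≡j)) p

  kernel : PriorityKernel W (suc h)
  kernel = record
    { classes = record
      { colour        = colour
      ; centre        = centre
      ; colour-sym    = colour-sym
      ; centre-≢      = centre-≢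
      ; centre-colour = centre-colour
      ; centre-meets  = λ {_} {u} {v} → centre-meets {u = u} {v}
      }
    ; gap        = gap
    ; nb         = nb
    ; priority   = priority
    ; nb-≢       = nb-≢
    ; nb-colour  = nb-colour
    ; gap-last   = gap-last
    ; decreasing = decreasing
    }

-- Orders four and five.

-- Kernels given by finite tables: the edges of each colour, and the values of
-- pick i that differ from centre i.
module Table {n k : ℕ} (colours : List ((Fin n × Fin n) × Fin k)) (centre : Fin k → Fin n × Fin n)
             (picks : Fin k → List ((Fin n × Fin n) × (Fin n × Fin n))) where

  _≈?_ : ∀ (e f : Fin n × Fin n) → Dec (e ≈ f)
  (u , v) ≈? (s , t) = (u ≟ᶠ s ×-dec v ≟ᶠ t) ⊎-dec (u ≟ᶠ t ×-dec v ≟ᶠ s)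

  meets? : ∀ (e f : Fin n × Fin n) → Dec (Meets e f)
  meets? (u , v) (s , t) = u ≟ᶠ s ⊎-dec u ≟ᶠ t ⊎-dec v ≟ᶠ s ⊎-dec v ≟ᶠ t

  find : ∀ {A : Set} → List ((Fin n × Fin n) × A) → Fin n → Fin n → Maybe A
  find []             u v = nothing
  find ((e , a) ∷ es) u v with (u , v) ≈? e
  ... | yes _ = just a
  ... | no  _ = find es u v

  colour : Fin n → Fin n → Maybe (Fin k)
  colour = find colours

  pick : Fin k → Fin n → Fin n → Fin n × Fin n
  pick i u v = fromMaybe (centre i) (find (picks i) u v)

  _≟ᶜ_ : (c d : Maybe (Fin k)) → Dec (c ≡ d)
  _≟ᶜ_ = Maybe.≡-dec _≟ᶠ_

  Valid : Set
  Valid = (∀ u v → colour u v ≡ colour v u)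
        × (∀ i → proj₁ (centre i) ≢ proj₂ (centre i) × uncurry colour (centre i) ≡ just i)
        × (∀ i u v → colour u v ≡ just i → Meets (u , v) (centre i))
        × (∀ i u v → u ≢ v → proj₁ (pick i u v) ≢ proj₂ (pick i u v)
                           × uncurry colour (pick i u v) ≡ just i × Meets (u , v) (pick i u v))
        × (∀ i u v → pick i u v ≡ pick i v u)
        -- Only `pick i u v` itself needs testing as the second edge; the symmetry of `pick`
        -- transfers the result along `≈`.
        × (∀ i j u v → i ≢ j → colour u v ≡ just j → ¬ uncurry (pick j) (pick i u v) ≈ (u , v))

  valid? : Dec Valid
  valid? = all? (λ u → all? λ v → colour u v ≟ᶜ colour v u)
    ×-dec all? (λ i → ¬? (proj₁ (centre i) ≟ᶠ proj₂ (centre i)) ×-dec uncurry colour (centre i) ≟ᶜ just i)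
    ×-dec all? (λ i → all? λ u → all? λ v → colour u v ≟ᶜ just i →-dec meets? (u , v) (centre i))
    ×-dec all? (λ i → all? λ u → all? λ v → ¬? (u ≟ᶠ v) →-dec
            (¬? (proj₁ (pick i u v) ≟ᶠ proj₂ (pick i u v))
              ×-dec uncurry colour (pick i u v) ≟ᶜ just i ×-dec meets? (u , v) (pick i u v)))
    ×-dec all? (λ i → all? λ u → all? λ v → ≡-dec _≟ᶠ_ _≟ᶠ_ (pick i u v) (pick i v u))
    ×-dec all? (λ i → all? λ j → all? λ u → all? λ v → ¬? (i ≟ᶠ j) →-dec (colour u v ≟ᶜ just j →-dec
            ¬? (uncurry (pick j) (pick i u v) ≈? (u , v))))

  kernel : Valid → LineKernel (Fin n) k
  kernel (c-sym , cen , cen-meets , pk , pk-sym , no-swap) = record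
    { classes = record
      { colour        = colour
      ; centre        = centre
      ; colour-sym    = c-sym
      ; centre-≢      = proj₁ ∘ cen
      ; centre-colour = proj₂ ∘ cen
      ; centre-meets  = cen-meets _ _ _
      }
    ; pick         = pick
    ; pick-≢       = λ i u≢v → proj₁ (pk i _ _ u≢v)
    ; pick-colour  = λ i u≢v → proj₁ (proj₂ (pk i _ _ u≢v))
    ; pick-meets   = λ i u≢v _ → proj₂ (proj₂ (pk i _ _ u≢v))
    ; pick-no-swap = λ {i} {j} {u} {v} i≢j _ c _ _ p q → no-swap i j u v i≢j c
        (subst (_≈ (u , v)) (sym (pick-≈ j p)) q)
    }
    where
    pick-≈ : ∀ j {e f} → e ≈ f → uncurry (pick j) e ≡ uncurry (pick j) f
    pick-≈ j (inj₁ (refl , refl)) = refl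
    pick-≈ j (inj₂ (refl , refl)) = pk-sym j _ _

infix 6 _↦_

_↦_ : {A B : Set} → A → B → A × B
_↦_ = _,_

-- The classes are the paths 0-2-3 and 0-3-1-2; the edge 01 is uncoloured.
kernel₄ : LineKernel (Fin 4) 2
kernel₄ = kernel (from-yes valid?)
  where
  colours : List ((Fin 4 × Fin 4) × Fin 2)
  colours = (0F , 2F) ↦ 0F ∷ (2F , 3F) ↦ 0F
          ∷ (0F , 3F) ↦ 1F ∷ (1F , 2F) ↦ 1F ∷ (1F , 3F) ↦ 1F ∷ []

  centre : Fin 2 → Fin 4 × Fin 4
  centre 0F = 2F , 3F
  centre 1F = 1F , 3F

  picks : Fin 2 → List ((Fin 4 × Fin 4) × (Fin 4 × Fin 4))
  picks 0F = (1F , 2F) ↦ (0F , 2F) ∷ (0F , 1F) ↦ (0F , 2F) ∷ []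
  picks 1F = (0F , 2F) ↦ (0F , 3F) ∷ (2F , 3F) ↦ (1F , 2F) ∷ []

  open Table colours centre picks using (kernel; valid?)

-- The classes are the paths 2-0-3-4, 0-4-2-1 and 4-1-3-2, each centred at its middle edge; the edge
-- 01 is uncoloured.
kernel₅ : LineKernel (Fin 5) 3
kernel₅ = kernel (from-yes valid?)
  where
  colours : List ((Fin 5 × Fin 5) × Fin 3)
  colours = (0F , 2F) ↦ 0F ∷ (0F , 3F) ↦ 0F ∷ (3F , 4F) ↦ 0F
          ∷ (0F , 4F) ↦ 1F ∷ (1F , 2F) ↦ 1F ∷ (2F , 4F) ↦ 1F
          ∷ (1F , 3F) ↦ 2F ∷ (1F , 4F) ↦ 2F ∷ (2F , 3F) ↦ 2F ∷ []

  centre : Fin 3 → Fin 5 × Fin 5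
  centre 0F = 0F , 3F
  centre 1F = 2F , 4F
  centre 2F = 1F , 3F

  picks : Fin 3 → List ((Fin 5 × Fin 5) × (Fin 5 × Fin 5))
  picks 0F = (0F , 4F) ↦ (3F , 4F) ∷ (1F , 2F) ↦ (0F , 2F) ∷ (2F , 4F) ↦ (0F , 2F)
           ∷ (1F , 3F) ↦ (3F , 4F) ∷ (1F , 4F) ↦ (3F , 4F) ∷ []
  picks 1F = (0F , 2F) ↦ (0F , 4F) ∷ (0F , 3F) ↦ (0F , 4F) ∷ (1F , 3F) ↦ (1F , 2F)
           ∷ (2F , 3F) ↦ (1F , 2F) ∷ (0F , 1F) ↦ (0F , 4F) ∷ []
  picks 2F = (0F , 2F) ↦ (2F , 3F) ∷ (3F , 4F) ↦ (2F , 3F) ∷ (0F , 4F) ↦ (1F , 4F)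
           ∷ (1F , 2F) ↦ (1F , 4F) ∷ (2F , 4F) ↦ (2F , 3F) ∷ []

  open Table colours centre picks using (kernel; valid?)

-- Deletions and the final case distinction.

CISTs-minus-one : ∀ {W : Set} {n k} (K : LineKernel W k) → Fin n ↔ W → ∀ {s t} → s ≢ t →
  LineKernel.colour K s t ≡ nothing → ∀ v → In (LK n) v → HasCISTs (LK n ─ (v ∷ [])) k
CISTs-minus-one K π s≢t c (x , y) x<y =
  CISTs-minus K π ((s≢t ∷ []) ∷ [] ∷ []) (c , tt) ((x≢y ∷ []) ∷ [] ∷ []) (inj₁ (refl , refl) ∷ []) refl
  where
  x≢y : x ≢ y
  x≢y refl = <-irrefl refl x<y

Fin↔pairs : ∀ k → Fin (k * 2) ↔ (Fin k × Bool)
Fin↔pairs k = (↔-id (Fin k) ×-↔ 2↔Bool) ↔-∘ *↔×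

Fin-suc↔Maybe : ∀ {n} {A : Set} → Fin n ↔ A → Fin (suc n) ↔ Maybe A
Fin-suc↔Maybe π = mk↔ₛ′
  (λ { zero → nothing ; (suc x) → just (to x) })
  (λ { nothing → zero ; (just a) → suc (from a) })
  (λ { nothing → refl ; (just a) → cong just (strictlyInverseˡ a) })
  (λ { zero → refl ; (suc x) → cong suc (strictlyInverseʳ x) })
  where open Inverse π using (to; from; strictlyInverseˡ; strictlyInverseʳ)

parity : ∀ n → ∃ λ k → n ≡ k * 2 ⊎ n ≡ 1 + k * 2
parity zero = 0 , inj₁ refl
parity (suc n) with parity n
... | k , inj₁ refl = k , inj₂ refl
... | k , inj₂ refl = suc k , inj₁ refl

even-% : ∀ k → (k * 2) % 2 ≢ 1
even-% k eq with trans (sym (m*n%n≡0 k 2)) eq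
... | ()

odd-% : ∀ k → (1 + k * 2) % 2 ≢ 0
odd-% k eq with trans (sym ([m+kn]%n≡m%n 1 k 2)) eq
... | ()

⌊2k/2⌋ : ∀ k → ⌊ k * 2 /2⌋ ≡ k
⌊2k/2⌋ zero    = refl
⌊2k/2⌋ (suc k) = cong suc (⌊2k/2⌋ k)

⌊2k+1/2⌋ : ∀ k → ⌊ suc (k * 2) /2⌋ ≡ k
⌊2k+1/2⌋ zero    = refl
⌊2k+1/2⌋ (suc k) = cong suc (⌊2k+1/2⌋ k)

-- A path with `length P` edges has one vertex more, so it is moved onto an initial segment of the
-- spine, which has `k` edges.
CISTs-minus-induced-path : ∀ m P → InducedPath (LK ((3 + m) * 2)) P → 1 ≤ length P → length P ≤ 3 + m →
  HasCISTs (LK ((3 + m) * 2) ─ P) (3 + m)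
CISTs-minus-induced-path m P@(e ∷ P′) ip _ P≤ with induced-path-trace e P′ ip
... | xs , uxs , al = CISTs-minus (fromPriorities kernel) (Fin↔pairs (3 + m))
    (Unique.applyUpTo⁺₁ spine (suc (length P)) (λ s<t t< → spine-≢ s<t (≤-trans (s≤s⁻¹ t<) P≤)))
    (chain-applyUpTo spine (suc (length P)) (λ t t< → spine-uncoloured (≤-trans (s≤s⁻¹ t<) P≤)))
    uxs al (trans (Along-length al) (sym (length-applyUpTo spine (suc (length P)))))
  where open Even m

theorem2 : (n : ℕ) → 4 ≤ n →
    HasCISTs (LK n) ⌊ suc n /2⌋
    × ((n ≡ 4 ⊎ (n % 2 ≡ 1)) → ∀ v → In (LK n) v → HasCISTs (LK n ─ (v ∷ [])) ⌊ suc n /2⌋)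
    × ((n % 2 ≡ 0) → 6 ≤ n → ∀ P → InducedPath (LK n) P → 1 ≤ length P → length P ≤ ⌊ n /2⌋ →
    HasCISTs (LK n ─ P) ⌊ suc n /2⌋)
theorem2 n 4≤n with parity n
theorem2 .0 ()             | 0 , inj₁ refl
theorem2 .2 (s≤s (s≤s ())) | 1 , inj₁ refl
theorem2 .1 (s≤s ())             | 0 , inj₂ refl
theorem2 .3 (s≤s (s≤s (s≤s ()))) | 1 , inj₂ refl
theorem2 .4 _ | 2 , inj₁ refl =
    CISTs-full kernel₄ (↔-id _)
  , (λ _ → CISTs-minus-one kernel₄ (↔-id _) {0F} {1F} (λ ()) refl)
  , λ { _ (s≤s (s≤s (s≤s (s≤s ())))) }
theorem2 .5 _ | 2 , inj₂ refl =
    CISTs-full kernel₅ (↔-id _)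
  , (λ _ → CISTs-minus-one kernel₅ (↔-id _) {0F} {1F} (λ ()) refl)
  , λ ()
theorem2 _ _ | suc (suc (suc m)) , inj₁ refl rewrite ⌊2k+1/2⌋ m | ⌊2k/2⌋ m =
    CISTs-full (fromPriorities (Even.kernel m)) (Fin↔pairs (3 + m))
  , (λ { (inj₂ odd) → ⊥-elim (even-% (3 + m) odd) })
  , λ _ _ → CISTs-minus-induced-path m
theorem2 _ _ | suc (suc (suc m)) , inj₂ refl rewrite ⌊2k/2⌋ m =
    CISTs-full K π
  -- The uncoloured edge is ∞a₁.
  , (λ _ → CISTs-minus-one K π {nothing} {just (1F , false)} (λ ()) refl)
  , λ even → ⊥-elim (odd-% (3 + m) even)
  where
  K = fromPriorities (Odd.kernel m)
  π = Fin-suc↔Maybe (Fin↔pairs (3 + m))
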